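{- Let $n\ge k\ge1$ and $m=\min\{n-k,k-1\}$. Then $$|\Pi_{n,k}/\sim_{cr}|=\sum_{l=0}^{m}\binom{k-1}{l}\Big[(n-k-1)l-\frac{l(l-1)}{2}+1\Big].$$ In particular, if $n\ge 2k-1$, then $|\Pi_{n,k}/\sim_{cr}|=(n-k-1)(k-1)2^{k-2}+2^{k-1}-(k-1)(k-2)2^{k-4}$.
   Context: $\Pi_{n,k}$ is the set of partitions of $[n]$ with $k$ blocks. Partitions are drawn with arcs joining consecutive elements of each block; $cr(\mu)$ is the number of pairs of arcs $(i_1,j_1),(i_2,j_2)$ with $i_1<i_2<j_1<j_2$. The tree of partitions has root the empty partition, and a partition $\mu$ of $[N+1]$ is a child of a partition $\nu$ of $[N]$ iff the restriction of $\mu$ to $\{2,\dots,N+1\}$ is order-isomorphic to $\nu$; $\mathcal{T}(\lambda,l,m)$ is the set of descendants of $\lambda$ at distance $l$ (i.e. partitions of $[n+l]$ whose restriction to the last $n$ elements is order-isomorphic to $\lambda\in\Pi_n$) having $m$ blocks. For $\lambda,\pi\in\Pi_n$, $\lambda\sim_{cr}\pi$ iff the multisets $\{cr(\mu):\mu\in\mathcal{T}(\lambda,l,m)\}$ and $\{cr(\mu):\mu\in\mathcal{T}(\pi,l,m)\}$ coincide for all $l,m\ge0$. $\Pi_{n,k}/\sim_{cr}$ is the set of equivalence classes of $\sim_{cr}$ restricted to $\Pi_{n,k}$. -}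

module Defs where

open import Data.Bool using (Bool; true; false; _∧_; if_then_else_)
open import Data.Nat using (ℕ; zero; suc; _+_; _*_; _∸_; _^_; _≤_; _⊔_; _⊓_; _<ᵇ_; _≡ᵇ_; _/_)
open import Data.Integer as ℤ using (ℤ; +_)
open import Data.Maybe using (Maybe; just; nothing)
open import Data.List using (List; []; _∷_; _++_; [_]; map; length; drop; concatMap; upTo; filterᵇ; cartesianProduct; foldr)
open import Data.List.Membership.Propositional using (_∈_)
open import Data.List.Relation.Unary.All using (All)
open import Data.List.Relation.Unary.Any using (Any)
open import Data.List.Relation.Unary.AllPairs using (AllPairs)
open import Data.List.Relation.Binary.Permutation.Propositional using (_↭_)
open import Data.Nat.Combinatorics using (_C_)
open import Data.Product using (Σ; _×_; _,_)
open import Relation.Nullary using (¬_)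
open import Relation.Binary.PropositionalEquality using (_≡_)

-- ENCODING: a set partition of [N] = {1,…,N} is represented by its restricted
-- growth string (RGS) a₁…a_N : element i lies in block a_i, blocks being labelled
-- 0,1,2,… in order of their minimal elements.  This is a bijective encoding.

ext : ℕ → ℕ → List (List ℕ)
ext b zero    = [] ∷ []
ext b (suc r) = concatMap (λ x → map (x ∷_) (ext (if x ≡ᵇ b then suc b else b) r)) (upTo (suc b))

Π : ℕ → List (List ℕ)
Π N = ext 0 N

nblocks : List ℕ → ℕ
nblocks = foldr (λ x acc → acc ⊔ suc x) 0

PartNK : ℕ → ℕ → List ℕ → Set
PartNK n k λ' = λ' ∈ Π n × nblocks λ' ≡ k

-- standardisation (relabel blocks by order of first occurrence), used to take
-- the order-isomorphism type of a restriction
indexOf : ℕ → List ℕ → Maybe ℕ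
indexOf x []       = nothing
indexOf x (y ∷ ys) = if x ≡ᵇ y then just 0 else Data.Maybe.map suc (indexOf x ys)
  where import Data.Maybe

std' : List ℕ → List ℕ → List ℕ
std' seen [] = []
std' seen (x ∷ xs) with indexOf x seen
... | just i  = i ∷ std' seen xs
... | nothing = length seen ∷ std' (seen ++ [ x ]) xs

std : List ℕ → List ℕ
std = std' []

-- arcs: (i , j) with i < j consecutive elements of the same block (0-based positions)
firstIndex : ℕ → List ℕ → Maybe ℕ
firstIndex = indexOf

arcs' : ℕ → List ℕ → List (ℕ × ℕ)
arcs' i [] = []
arcs' i (x ∷ xs) with firstIndex x xs
... | just d  = (i , i + suc d) ∷ arcs' (suc i) xs
... | nothing = arcs' (suc i) xs

arcs : List ℕ → List (ℕ × ℕ)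
arcs = arcs' 0

crosses : (ℕ × ℕ) × (ℕ × ℕ) → Bool
crosses ((i₁ , j₁) , (i₂ , j₂)) = (i₁ <ᵇ i₂) ∧ ((i₂ <ᵇ j₁) ∧ (j₁ <ᵇ j₂))

cr : List ℕ → ℕ
cr μ = length (filterᵇ crosses (cartesianProduct (arcs μ) (arcs μ)))

listEqᵇ : List ℕ → List ℕ → Bool
listEqᵇ [] [] = true
listEqᵇ (x ∷ xs) (y ∷ ys) = (x ≡ᵇ y) ∧ listEqᵇ xs ys
listEqᵇ _ _ = false

-- 𝒯(λ,l,m): partitions of [n+l] whose restriction to the last n elements is
-- order-isomorphic to λ ∈ Π_n, having m blocks
Tdesc : List ℕ → ℕ → ℕ → List (List ℕ)
Tdesc λ' l m = filterᵇ (λ μ → listEqᵇ (std (drop l μ)) λ' ∧ (nblocks μ ≡ᵇ m)) (Π (l + length λ'))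

_∼cr_ : List ℕ → List ℕ → Set
λ' ∼cr π = ∀ l m → map cr (Tdesc λ' l m) ↭ map cr (Tdesc π l m)

NumClasses : ℕ → ℕ → ℕ → Set
NumClasses n k N =
  Σ (List (List ℕ)) λ reps →
    length reps ≡ N
    × All (PartNK n k) reps
    × AllPairs (λ a b → ¬ (a ∼cr b)) reps
    × (∀ λ' → PartNK n k λ' → Any (λ ρ → λ' ∼cr ρ) reps)

formula : ℕ → ℕ → ℤ
formula n k = foldr ℤ._+_ (+ 0) (map term (upTo (suc m)))
  where
  m = (n ∸ k) ⊓ (k ∸ 1)
  term : ℕ → ℤ
  term l = (+ ((k ∸ 1) C l)) ℤ.* ((((+ n) ℤ.- (+ k) ℤ.- (+ 1)) ℤ.* (+ l)) ℤ.- (+ ((l * (l ∸ 1)) / 2)) ℤ.+ (+ 1))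

-- 16 · [ (n-k-1)(k-1)2^{k-2} + 2^{k-1} - (k-1)(k-2)2^{k-4} ]
--   = (n-k-1)(k-1)2^{k+2} + 2^{k+3} - (k-1)(k-2)2^{k}   (in ℤ)
closed16 : ℕ → ℕ → ℤ
closed16 n k =
  (((+ n) ℤ.- (+ k) ℤ.- (+ 1)) ℤ.* (+ (k ∸ 1)) ℤ.* (+ (2 ^ (k + 2))))
  ℤ.+ (+ (2 ^ (k + 3)))
  ℤ.- ((+ (k ∸ 1)) ℤ.* (+ (k ∸ 2)) ℤ.* (+ (2 ^ k)))

{-# OPTIONS --safe #-}
module Submission where

-- To a partition attach cr and the list c₁ … c_k, where c_i counts the arcs covering the minimum of
-- the i-th block.  Prepending an element either starts a block (the list becomes 0 c₁ … c_k) or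
-- attaches to block i, which adds c_i crossings and turns the list into
-- 0 (c₁+1) … (c_{i-1}+1) c_{i+1} … c_k.  The generating function of the descendants is affine in
-- q^{c_i}, and this makes it symmetric in the c_i; levels 0 and 1 of the tree recover cr and the
-- multiset of the c_i.  So classes correspond to pairs (cr , multiset of the c_i).
-- Since c₁ = 0 and c_{i+1} ≤ c_i + 1, the multiset has support {0,…,l}, which leaves C(k-1,l)
-- choices, and with a = n - k arcs cr takes exactly the values 0, …, Σ_{t<a} min(t,l).

open import Defs
open import Data.Bool using (Bool; true; false; _∧_; if_then_else_; T; T?)
open import Data.Bool.Properties using (T-∧)
open import Data.Empty using (⊥-elim)
open import Data.List using (List; []; _∷_; _++_; [_]; map; length; drop; concat; concatMap; filterᵇ; foldr; cartesianProduct; upTo; applyUpTo)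
open import Data.List.Properties
open import Data.List.Membership.Propositional using (_∈_; _∉_; find; lose)
open import Data.List.Membership.Propositional.Properties
open import Data.List.Membership.Propositional.Properties.WithK using (unique∧set⇒bag)
open import Data.List.Relation.Binary.BagAndSetEquality using (∼bag⇒↭)
open import Data.List.Relation.Binary.Permutation.Propositional using (_↭_; prep; swap; ↭-refl; ↭-sym; ↭-trans; ↭⇒↭ₛ)
import Data.List.Relation.Binary.Permutation.Propositional.Properties as Perm
open import Data.List.Relation.Binary.Pointwise using (Pointwise; []; _∷_; Pointwise-length)
open import Data.List.Relation.Unary.All using (All; []; _∷_)
import Data.List.Relation.Unary.All as All
import Data.List.Relation.Unary.All.Properties as Allₚ
open import Data.List.Relation.Unary.AllPairs using (AllPairs; []; _∷_)
open import Data.List.Relation.Unary.Any using (Any; here; there)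
open import Data.List.Relation.Unary.Unique.Propositional using (Unique)
import Data.List.Relation.Unary.Unique.Propositional.Properties as Uniq
open import Data.Maybe using (Maybe; just; nothing)
import Data.Maybe as Maybe
open import Data.Maybe.Properties using (just-injective)
open import Data.Nat
open import Data.Nat.Combinatorics using (_C_; nCk≡nC[n∸k]; nCn≡1; k>n⇒nCk≡0; nCk+nC[k+1]≡[n+1]C[k+1])
open import Data.Nat.DivMod using (m*n/n≡m)
open import Data.Nat.ListAction using (sum)
open import Data.Nat.Properties
open import Data.Nat.Tactic.RingSolver using (solve-∀)
open import Data.Product using (Σ; ∃; _×_; _,_; proj₁; proj₂; map₁; map₂)
open import Data.Sum using (_⊎_; inj₁; inj₂)
open import Function using (case_of_; mk⇔; Equivalence)
open import Relation.Nullary using (¬_; yes; no)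
open import Relation.Binary.PropositionalEquality using (_≡_; _≢_; refl; sym; trans; cong; cong₂; subst; subst₂; setoid; module ≡-Reasoning)
open import Data.List.Membership.DecPropositional _≟_ using (_∈?_)
open import Data.List.Relation.Binary.Permutation.Setoid.Properties (setoid ℕ) using (Unique-resp-↭)

-- States (cr , c₁ … c_k) and the symmetry of their descendants

-- Affinity gives symmetry as follows. Exchange neighbouring entries a and b. The branches that
-- attach to one of the two are affine in the surviving entry. They contribute terms at v + a and v
-- + b from the constant parts, and terms at v + a + b and v + a + b + 1 from the other parts. This
-- list is the same for both orders, and all other branches are handled one level down. In place of
-- polynomials in q, an arbitrary weight on final states is summed; indicator weights then return
-- multiplicities. Attaining every value of cr is harder than bounding it, because an attachment
-- also changes the remaining entries. The remedy is a potential: cr plus the sum of the entries not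
-- yet built into the target list. Attaching at position i among those entries raises the potential
-- by i, whatever their values. With a arcs and maximum l, the first a - l attachments choose among
-- l + 1 entries and the last l among l, l - 1, ..., 1 entries. The increments are free within these
-- ranges and at the end no such entry is left, so every value up to the bound occurs.

State : Set
State = ℕ × List ℕ

picks : List ℕ → List (ℕ × List ℕ)
picks []       = []
picks (c ∷ cs) = (c , cs) ∷ map (map₂ (suc c ∷_)) (picks cs)

attach : ℕ → ℕ × List ℕ → State
attach v (d , ds) = v + d , 0 ∷ ds

successors : State → List State
successors (v , cs) = (v , 0 ∷ cs) ∷ map (attach v) (picks cs)

descendants : ℕ → State → List State
descendants zero    s = s ∷ []
descendants (suc l) s = concatMap (descendants l) (successors s)

values : ℕ → List State → List ℕ
values m ss = map proj₁ (filterᵇ (λ s → length (proj₂ s) ≡ᵇ m) ss)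

δ : ℕ → ℕ → ℕ
δ t x = if t ≡ᵇ x then 1 else 0

occ : ℕ → List ℕ → ℕ
occ t []       = 0
occ t (x ∷ xs) = δ t x + occ t xs

δ-refl : ∀ x → δ x x ≡ 1
δ-refl zero    = refl
δ-refl (suc x) = δ-refl x

δ-≢ : ∀ t x → t ≢ x → δ t x ≡ 0
δ-≢ zero    zero    t≢x = ⊥-elim (t≢x refl)
δ-≢ zero    (suc x) t≢x = refl
δ-≢ (suc t) zero    t≢x = refl
δ-≢ (suc t) (suc x) t≢x = δ-≢ t x λ t≡x → t≢x (cong suc t≡x)

occ-++ : ∀ t xs ys → occ t (xs ++ ys) ≡ occ t xs + occ t ys
occ-++ t []       ys = refl
occ-++ t (x ∷ xs) ys = trans (cong (δ t x +_) (occ-++ t xs ys)) (sym (+-assoc (δ t x) _ _))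

occ⇒∈ : ∀ t xs → occ t xs ≢ 0 → t ∈ xs
occ⇒∈ t []       o≢0 = ⊥-elim (o≢0 refl)
occ⇒∈ t (x ∷ xs) o≢0 with t ≟ x
... | yes t≡x = here t≡x
... | no  t≢x = there (occ⇒∈ t xs λ o≡0 → o≢0 (cong₂ _+_ (δ-≢ t x t≢x) o≡0))

occ⇒↭ : ∀ xs ys → (∀ t → occ t xs ≡ occ t ys) → xs ↭ ys
occ⇒↭ [] []       same = ↭-refl
occ⇒↭ [] (y ∷ ys) same
  with () ← trans (same y) (cong (_+ occ y ys) (δ-refl y))
occ⇒↭ (x ∷ xs) ys same
  with ∈-∃++ (occ⇒∈ x ys λ o≡0 → 0≢1+n (trans (sym o≡0) (trans (sym (same x)) (cong (_+ occ x xs) (δ-refl x)))))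
... | us , vs , refl = ↭-trans (prep x (occ⇒↭ xs (us ++ vs) same′)) (↭-sym (Perm.shift x us vs))
  where
  same′ : ∀ t → occ t xs ≡ occ t (us ++ vs)
  same′ t = +-cancelˡ-≡ (δ t x) _ _ (begin
    δ t x + occ t xs               ≡⟨ same t ⟩
    occ t (us ++ x ∷ vs)           ≡⟨ occ-++ t us (x ∷ vs) ⟩
    occ t us + (δ t x + occ t vs)  ≡⟨ swapˡ (occ t us) (δ t x) (occ t vs) ⟩
    δ t x + (occ t us + occ t vs)  ≡⟨ cong (δ t x +_) (occ-++ t us vs) ⟨
    δ t x + occ t (us ++ vs)       ∎)
    where
    open ≡-Reasoning
    swapˡ : ∀ a b c → a + (b + c) ≡ b + (a + c)
    swapˡ = solve-∀

-- The sum over `picks` without building that list: a passed-over head is absorbed, incremented,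
-- into the function, so inductions run directly on the entries.
sumPicks : (ℕ → List ℕ → ℕ) → List ℕ → ℕ
sumPicks h []       = 0
sumPicks h (c ∷ cs) = h c cs + sumPicks (λ d ds → h d (suc c ∷ ds)) cs

sumPicks-cong : ∀ {h h′} → (∀ d ds → h d ds ≡ h′ d ds) → ∀ cs → sumPicks h cs ≡ sumPicks h′ cs
sumPicks-cong eq []       = refl
sumPicks-cong eq (c ∷ cs) = cong₂ _+_ (eq c cs) (sumPicks-cong (λ d ds → eq d (suc c ∷ ds)) cs)

+-interchange : ∀ a b c d → (a + b) + (c + d) ≡ (a + c) + (b + d)
+-interchange = solve-∀

sumPicks-+ : ∀ h h′ cs → sumPicks (λ d ds → h d ds + h′ d ds) cs ≡ sumPicks h cs + sumPicks h′ cs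
sumPicks-+ h h′ []       = refl
sumPicks-+ h h′ (c ∷ cs) =
  trans (cong (h c cs + h′ c cs +_) (sumPicks-+ _ _ cs)) (+-interchange (h c cs) _ _ _)

sumPicks-++ : ∀ h X b Y → sumPicks h (X ++ b ∷ Y) ≡
  sumPicks (λ d ds → h d (ds ++ b ∷ Y)) X
    + (h b (map suc X ++ Y) + sumPicks (λ d ds → h d (map suc X ++ suc b ∷ ds)) Y)
sumPicks-++ h []      b Y = refl
sumPicks-++ h (x ∷ X) b Y =
  trans (cong (h x (X ++ b ∷ Y) +_) (sumPicks-++ (λ d ds → h d (suc x ∷ ds)) X b Y))
        (sym (+-assoc (h x (X ++ b ∷ Y)) _ _))

-- `g` weighs a final state by its crossing number and its number of blocks, in the role of a power
-- of q. Leaving it arbitrary lets one identity serve for all coefficients.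
module Weighted (g : ℕ → ℕ → ℕ) where

  total : ℕ → ℕ → List ℕ → ℕ
  total zero    v cs = g v (length cs)
  total (suc l) v cs = total l v (0 ∷ cs) + sumPicks (λ d ds → total l (v + d) (0 ∷ ds)) cs

  -- The descendants of (v , X ++ b ∷ Y) that never attach to the block counted by b, and those that do,
  -- the latter with the contribution b of that block moved into the argument v.
  unused used : ℕ → ℕ → List ℕ → List ℕ → ℕ
  unused zero    v X Y = g v (suc (length X + length Y))
  unused (suc l) v X Y =
    unused l v (0 ∷ X) Y
      + (sumPicks (λ x X′ → unused l (v + x) (0 ∷ X′) Y) X
        + sumPicks (λ y Y′ → unused l (v + y) (0 ∷ map suc X) Y′) Y)
  used zero    v X Y = 0
  used (suc l) v X Y =
    used l v (0 ∷ X) Y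
      + (sumPicks (λ x X′ → used l (v + x) (0 ∷ X′) Y) X
        + (total l v (0 ∷ map suc X ++ Y)
          + sumPicks (λ y Y′ → used l (suc (v + y)) (0 ∷ map suc X) Y′) Y))

  -- Affinity in b: until the block is attached to, its count is only incremented, and the
  -- increments do not depend on b. The first attachment moves the count into the crossing number
  -- and replaces the entry by a new 0. So b enters solely through the argument v + b of `used`.
  total-split : ∀ l v X b Y → total l v (X ++ b ∷ Y) ≡ unused l v X Y + used l (v + b) X Y
  total-split zero    v X b Y = trans (cong (g v) (trans (length-++ X) (+-suc _ _))) (sym (+-identityʳ _))
  total-split (suc l) v X b Y = begin
    total l v (0 ∷ X ++ b ∷ Y) + sumPicks (λ d ds → total l (v + d) (0 ∷ ds)) (X ++ b ∷ Y)
      ≡⟨ cong₂ _+_ (total-split l v (0 ∷ X) b Y) (sumPicks-++ _ X b Y) ⟩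
    (p + p′) + (sumPicks (λ d ds → total l (v + d) (0 ∷ ds ++ b ∷ Y)) X
      + (total l (v + b) (0 ∷ map suc X ++ Y)
        + sumPicks (λ d ds → total l (v + d) (0 ∷ map suc X ++ suc b ∷ ds)) Y))
      ≡⟨ cong (λ z → (p + p′) + z) (cong₂ (λ x y → x + (t + y)) inX inY) ⟩
    (p + p′) + ((q + q′) + (t + (r + r′)))
      ≡⟨ rearrange p p′ q q′ t r r′ ⟩
    (p + (q + r)) + (p′ + (q′ + (t + r′))) ∎
    where
    open ≡-Reasoning
    p = unused l v (0 ∷ X) Y
    p′ = used l (v + b) (0 ∷ X) Y
    q = sumPicks (λ x X′ → unused l (v + x) (0 ∷ X′) Y) X
    q′ = sumPicks (λ x X′ → used l (v + b + x) (0 ∷ X′) Y) X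
    t = total l (v + b) (0 ∷ map suc X ++ Y)
    r = sumPicks (λ y Y′ → unused l (v + y) (0 ∷ map suc X) Y′) Y
    r′ = sumPicks (λ y Y′ → used l (suc (v + b + y)) (0 ∷ map suc X) Y′) Y
    swapʳ : ∀ a b c → a + b + c ≡ a + c + b
    swapʳ = solve-∀
    swapʳ′ : ∀ a b c → a + b + suc c ≡ suc (a + c + b)
    swapʳ′ = solve-∀
    rearrange : ∀ p p′ q q′ t r r′ →
      (p + p′) + ((q + q′) + (t + (r + r′))) ≡ (p + (q + r)) + (p′ + (q′ + (t + r′)))
    rearrange = solve-∀
    inX : sumPicks (λ d ds → total l (v + d) (0 ∷ ds ++ b ∷ Y)) X ≡ q + q′
    inX = trans (sumPicks-cong (λ d ds → trans (total-split l (v + d) (0 ∷ ds) b Y)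
                  (cong (λ z → unused l (v + d) (0 ∷ ds) Y + used l z (0 ∷ ds) Y) (swapʳ v d b))) X)
                (sumPicks-+ _ _ X)
    inY : sumPicks (λ d ds → total l (v + d) (0 ∷ map suc X ++ suc b ∷ ds)) Y ≡ r + r′
    inY = trans (sumPicks-cong (λ d ds → trans (total-split l (v + d) (0 ∷ map suc X) (suc b) ds)
                  (cong (λ z → unused l (v + d) (0 ∷ map suc X) ds + used l z (0 ∷ map suc X) ds) (swapʳ′ v d b))) Y)
                (sumPicks-+ _ _ Y)

  total-swap : ∀ l v X a b Y → total l v (X ++ a ∷ b ∷ Y) ≡ total l v (X ++ b ∷ a ∷ Y)
  total-swap zero    v X a b Y = cong (g v) (trans (length-++ X) (sym (length-++ X)))
  total-swap (suc l) v X a b Y = begin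
    total l v (0 ∷ X ++ a ∷ b ∷ Y) + sumPicks h (X ++ a ∷ b ∷ Y)
      ≡⟨ cong₂ _+_ (total-swap l v (0 ∷ X) a b Y) (sumPicks-++ h X a (b ∷ Y)) ⟩
    total l v (0 ∷ X ++ b ∷ a ∷ Y) + (sumPicks (λ d ds → h d (ds ++ a ∷ b ∷ Y)) X
      + (h a (map suc X ++ b ∷ Y) + (h b (map suc X ++ suc a ∷ Y)
        + sumPicks (λ d ds → h d (map suc X ++ suc a ∷ suc b ∷ ds)) Y)))
      ≡⟨ cong (total l v (0 ∷ X ++ b ∷ a ∷ Y) +_) (cong₂ _+_
           (sumPicks-cong (λ d ds → total-swap l (v + d) (0 ∷ ds) a b Y) X)
           (middle (sumPicks-cong (λ d ds → total-swap l (v + d) (0 ∷ map suc X) (suc a) (suc b) ds) Y))) ⟩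
    total l v (0 ∷ X ++ b ∷ a ∷ Y) + (sumPicks (λ d ds → h d (ds ++ b ∷ a ∷ Y)) X
      + (h b (map suc X ++ a ∷ Y) + (h a (map suc X ++ suc b ∷ Y)
        + sumPicks (λ d ds → h d (map suc X ++ suc b ∷ suc a ∷ ds)) Y)))
      ≡⟨ cong (total l v (0 ∷ X ++ b ∷ a ∷ Y) +_) (sumPicks-++ h X b (a ∷ Y)) ⟨
    total l v (0 ∷ X ++ b ∷ a ∷ Y) + sumPicks h (X ++ b ∷ a ∷ Y) ∎
    where
    open ≡-Reasoning
    h : ℕ → List ℕ → ℕ
    h d ds = total l (v + d) (0 ∷ ds)
    split : ∀ c x → h c (map suc X ++ x ∷ Y) ≡ unused l (v + c) (0 ∷ map suc X) Y + used l (v + c + x) (0 ∷ map suc X) Y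
    split c x = total-split l (v + c) (0 ∷ map suc X) x Y
    e₁ : ∀ v a b → v + a + b ≡ v + b + a
    e₁ = solve-∀
    e₂ : ∀ v a b → v + b + suc a ≡ v + a + suc b
    e₂ = solve-∀
    e₃ : ∀ p q r s t → (p + q) + ((r + s) + t) ≡ (r + q) + ((p + s) + t)
    e₃ = solve-∀
    middle : ∀ {z z′} → z ≡ z′ →
      h a (map suc X ++ b ∷ Y) + (h b (map suc X ++ suc a ∷ Y) + z)
        ≡ h b (map suc X ++ a ∷ Y) + (h a (map suc X ++ suc b ∷ Y) + z′)
    middle {z} refl
      rewrite split a b | split b (suc a) | split b a | split a (suc b) | e₁ v a b | e₂ v a b
      = e₃ (unused l (v + a) (0 ∷ map suc X) Y) _ (unused l (v + b) (0 ∷ map suc X) Y)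
           (used l (v + a + suc b) (0 ∷ map suc X) Y) z

  -- The prefix X takes up the heads passed by `prep` and `swap`, since `total` does not decompose
  -- along the list.
  total-↭ : ∀ l v X {cs cs′} → cs ↭ cs′ → total l v (X ++ cs) ≡ total l v (X ++ cs′)
  total-↭ l v X _↭_.refl      = refl
  total-↭ l v X (prep {xs} {ys} x p) = begin
    total l v (X ++ x ∷ xs)      ≡⟨ cong (total l v) (++-assoc X [ x ] xs) ⟨
    total l v ((X ++ [ x ]) ++ xs) ≡⟨ total-↭ l v (X ++ [ x ]) p ⟩
    total l v ((X ++ [ x ]) ++ ys) ≡⟨ cong (total l v) (++-assoc X [ x ] ys) ⟩
    total l v (X ++ x ∷ ys)      ∎
    where open ≡-Reasoning
  total-↭ l v X (swap {xs} {ys} x y p) = begin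
    total l v (X ++ x ∷ y ∷ xs)      ≡⟨ total-swap l v X x y xs ⟩
    total l v (X ++ y ∷ x ∷ xs)      ≡⟨ cong (total l v) (++-assoc X (y ∷ x ∷ []) xs) ⟨
    total l v ((X ++ y ∷ x ∷ []) ++ xs) ≡⟨ total-↭ l v (X ++ y ∷ x ∷ []) p ⟩
    total l v ((X ++ y ∷ x ∷ []) ++ ys) ≡⟨ cong (total l v) (++-assoc X (y ∷ x ∷ []) ys) ⟩
    total l v (X ++ y ∷ x ∷ ys)      ∎
    where open ≡-Reasoning
  total-↭ l v X (_↭_.trans p q) = trans (total-↭ l v X p) (total-↭ l v X q)

module _ (t m : ℕ) where

  -- With this weight `total` counts the descendants with m blocks and crossing number t, which is
  -- the multiplicity that a comparison of multisets needs.
  indicator : ℕ → ℕ → ℕ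
  indicator v k = if k ≡ᵇ m then δ t v else 0

  open Weighted indicator

  weight : List State → ℕ
  weight ss = occ t (values m ss)

  weight-∷ : ∀ s ss → weight (s ∷ ss) ≡ indicator (proj₁ s) (length (proj₂ s)) + weight ss
  weight-∷ (v , cs) ss with length cs ≡ᵇ m
  ... | true  = refl
  ... | false = refl

  weight-++ : ∀ ss ss′ → weight (ss ++ ss′) ≡ weight ss + weight ss′
  weight-++ []       ss′ = refl
  weight-++ (s ∷ ss) ss′ = begin
    weight (s ∷ ss ++ ss′)                ≡⟨ weight-∷ s (ss ++ ss′) ⟩
    w + weight (ss ++ ss′)                ≡⟨ cong (w +_) (weight-++ ss ss′) ⟩
    w + (weight ss + weight ss′)          ≡⟨ +-assoc w _ _ ⟨
    w + weight ss + weight ss′            ≡⟨ cong (_+ weight ss′) (weight-∷ s ss) ⟨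
    weight (s ∷ ss) + weight ss′          ∎
    where
    open ≡-Reasoning
    w = indicator (proj₁ s) (length (proj₂ s))

  weight-picks : ∀ {A : Set} (F : A → List State) (f : ℕ × List ℕ → A) cs →
    weight (concatMap F (map f (picks cs))) ≡ sumPicks (λ d ds → weight (F (f (d , ds)))) cs
  weight-picks F f []       = refl
  weight-picks F f (c ∷ cs) = trans (weight-++ (F (f (c , cs))) _) (cong (weight (F (f (c , cs))) +_)
    (trans (cong (λ z → weight (concat (map F z))) (sym (map-∘ (picks cs))))
           (weight-picks F (λ p → f (map₂ (suc c ∷_) p)) cs)))

  weight-descendants : ∀ l v cs → weight (descendants l (v , cs)) ≡ total l v cs
  weight-descendants zero    v cs = trans (weight-∷ (v , cs) []) (+-identityʳ _)
  weight-descendants (suc l) v cs = trans (weight-++ (descendants l (v , 0 ∷ cs)) _)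
    (cong₂ _+_ (weight-descendants l v (0 ∷ cs))
      (trans (weight-picks (descendants l) (attach v) cs)
             (sumPicks-cong (λ d ds → weight-descendants l (v + d) (0 ∷ ds)) cs)))

values-descendants-↭ : ∀ l m v {cs cs′} → cs ↭ cs′ →
  values m (descendants l (v , cs)) ↭ values m (descendants l (v , cs′))
values-descendants-↭ l m v {cs} {cs′} p = occ⇒↭ _ _ λ t →
  trans (weight-descendants t m l v cs)
    (trans (Weighted.total-↭ (indicator t m) l v [] p) (sym (weight-descendants t m l v cs′)))

-- The state of a word

-- A block label paired with the number of arcs covering the first occurrence of that label.
Entries : Set
Entries = List (ℕ × ℕ)

-- `picks` addressed by block label instead of position; `nothing` signals that the label opens a
-- new block.
extract : ℕ → Entries → Maybe (ℕ × Entries)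
extract x [] = nothing
extract x ((y , c) ∷ ps) with x ≟ y
... | yes _ = just (c , ps)
... | no  _ = Maybe.map (map₂ ((y , suc c) ∷_)) (extract x ps)

place : ℕ → ℕ × Entries → Maybe (ℕ × Entries) → ℕ × Entries
place x (v , ps) nothing         = v , (x , 0) ∷ ps
place x (v , ps) (just (d , qs)) = v + d , (x , 0) ∷ qs

prepend : ℕ → ℕ × Entries → ℕ × Entries
prepend x p = place x p (extract x (proj₂ p))

-- Words are read from the right because descendants grow on the left. The letter just read comes
-- first, so entries stay in the order of first occurrences.
profile : List ℕ → ℕ × Entries
profile []       = 0 , []
profile (x ∷ xs) = prepend x (profile xs)

entries : List ℕ → Entries
entries w = proj₂ (profile w)

labels : List ℕ → List ℕ
labels w = map proj₁ (entries w)

state : List ℕ → State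
state w = map₂ (map proj₂) (profile w)

data Extract (x : ℕ) (ps : Entries) : Set where
  absent  : extract x ps ≡ nothing → x ∉ map proj₁ ps → Extract x ps
  present : ∀ P d Q → ps ≡ P ++ (x , d) ∷ Q → extract x ps ≡ just (d , map (map₂ suc) P ++ Q) → Extract x ps

extract? : ∀ x ps → Extract x ps
extract? x [] = absent refl λ ()
extract? x ((y , c) ∷ ps) with x ≟ y in eq
... | yes refl = present [] c ps refl (lem eq)
  where
  lem : (x ≟ x) ≡ yes refl → extract x ((x , c) ∷ ps) ≡ just (c , ps)
  lem e rewrite e = refl
... | no x≢y with extract? x ps
...   | absent e x∉ = absent (lem eq) λ { (here x≡y) → x≢y x≡y ; (there x∈) → x∉ x∈ }
  where
  lem : (x ≟ y) ≡ no x≢y → extract x ((y , c) ∷ ps) ≡ nothing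
  lem e′ rewrite e′ | e = refl
...   | present P d Q refl e = present ((y , c) ∷ P) d Q refl (lem eq)
  where
  lem : (x ≟ y) ≡ no x≢y → extract x ((y , c) ∷ P ++ (x , d) ∷ Q) ≡ just (d , (y , suc c) ∷ map (map₂ suc) P ++ Q)
  lem e′ rewrite e′ | e = refl

map-proj₁-++ : ∀ (P Q : Entries) → map proj₁ (map (map₂ suc) P ++ Q) ≡ map proj₁ (P ++ Q)
map-proj₁-++ []      Q = refl
map-proj₁-++ (p ∷ P) Q = cong (proj₁ p ∷_) (map-proj₁-++ P Q)

data Prepend (x : ℕ) (w : List ℕ) : Set where
  fresh : x ∉ labels w → profile (x ∷ w) ≡ (proj₁ (profile w) , (x , 0) ∷ entries w) → Prepend x w
  moved : ∀ P d Q → entries w ≡ P ++ (x , d) ∷ Q →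
    profile (x ∷ w) ≡ (proj₁ (profile w) + d , (x , 0) ∷ map (map₂ suc) P ++ Q) → Prepend x w

prepend? : ∀ x w → Prepend x w
prepend? x w with extract? x (entries w)
... | absent e x∉          = fresh x∉ (cong (place x (profile w)) e)
... | present P d Q split e = moved P d Q split (cong (place x (profile w)) e)

labels-moved : ∀ x w {P d Q v} → entries w ≡ P ++ (x , d) ∷ Q →
  profile (x ∷ w) ≡ (v , (x , 0) ∷ map (map₂ suc) P ++ Q) → labels (x ∷ w) ↭ labels w
labels-moved x w {P} {d} {Q} split eq rewrite eq | split | map-proj₁-++ P Q
  = ↭-sym (Perm.map⁺ proj₁ (Perm.shift (x , d) P Q))

∈-split : ∀ x {ps : Entries} {P d Q} → ps ≡ P ++ (x , d) ∷ Q → x ∈ map proj₁ ps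
∈-split x {P = P} refl = ∈-map⁺ proj₁ (∈-++⁺ʳ P (here refl))

∈⇒∈labels : ∀ {x} w → x ∈ w → x ∈ labels w
∈⇒∈labels (y ∷ w) x∈ with prepend? y w
∈⇒∈labels (y ∷ w) (here refl) | fresh _ eq rewrite eq = here refl
∈⇒∈labels (y ∷ w) (there x∈)  | fresh _ eq rewrite eq = there (∈⇒∈labels w x∈)
∈⇒∈labels (y ∷ w) (here refl) | moved P d Q split eq =
  Perm.∈-resp-↭ (↭-sym (labels-moved y w split eq)) (∈-split y split)
∈⇒∈labels (y ∷ w) (there x∈)  | moved P d Q split eq =
  Perm.∈-resp-↭ (↭-sym (labels-moved y w split eq)) (∈⇒∈labels w x∈)

∈labels⇒∈ : ∀ {x} w → x ∈ labels w → x ∈ w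
∈labels⇒∈ (y ∷ w) x∈ with prepend? y w
∈labels⇒∈ (y ∷ w) x∈ | moved P d Q split eq = there (∈labels⇒∈ w (Perm.∈-resp-↭ (labels-moved y w split eq) x∈))
∈labels⇒∈ (y ∷ w) x∈ | fresh _ eq rewrite eq with x∈
... | here refl = here refl
... | there x∈′ = there (∈labels⇒∈ w x∈′)

labels-unique : ∀ w → Unique (labels w)
labels-unique [] = []
labels-unique (y ∷ w) with prepend? y w
... | fresh y∉ eq rewrite eq = Allₚ.¬Any⇒All¬ _ y∉ ∷ labels-unique w
... | moved P d Q split eq = Unique-resp-↭ (↭⇒↭ₛ (↭-sym (labels-moved y w split eq))) (labels-unique w)

InjOn : (ℕ → ℕ) → List ℕ → Set
InjOn f w = ∀ {x y} → x ∈ w → y ∈ w → f x ≡ f y → x ≡ y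

InjOn-⊆ : ∀ {f u w} → (∀ {x} → x ∈ u → x ∈ w) → InjOn f w → InjOn f u
InjOn-⊆ u⊆w inj x∈ y∈ = inj (u⊆w x∈) (u⊆w y∈)

extract-map : ∀ f x ps → InjOn f (x ∷ map proj₁ ps) →
  extract (f x) (map (map₁ f) ps) ≡ Maybe.map (map₂ (map (map₁ f))) (extract x ps)
extract-map f x [] inj = refl
extract-map f x ((y , c) ∷ ps) inj with x ≟ y | f x ≟ f y
... | yes refl | yes _   = refl
... | yes refl | no  ≢   = ⊥-elim (≢ refl)
... | no  x≢y  | yes fx≡ = ⊥-elim (x≢y (inj (here refl) (there (here refl)) fx≡))
... | no  x≢y  | no  _   rewrite extract-map f x ps (InjOn-⊆ (λ { (here e) → here e ; (there z) → there (there z) }) inj)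
  with extract x ps
...   | nothing = refl
...   | just _  = refl

-- Labels are only ever compared for equality, so a relabelling that is injective on the letters
-- passes through.
profile-map : ∀ f w → InjOn f w → profile (map f w) ≡ map₂ (map (map₁ f)) (profile w)
profile-map f []      inj = refl
profile-map f (x ∷ w) inj rewrite profile-map f w (InjOn-⊆ there inj)
  | extract-map f x (entries w) (InjOn-⊆ (λ { (here e) → here e ; (there z) → there (∈labels⇒∈ w z) }) inj)
  with extract x (entries w)
... | nothing = refl
... | just _  = refl

state-map : ∀ f w → InjOn f w → state (map f w) ≡ state w
state-map f w inj rewrite profile-map f w inj = cong (proj₁ (profile w) ,_) (sym (map-∘ (entries w)))

strip : ℕ × Entries → ℕ × List ℕ
strip = map₂ (map proj₂)

-- Distinct labels address distinct positions, so running through them visits the choices in the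
-- order of `picks`.
extract-labels : ∀ ps → Unique (map proj₁ ps) →
  map (λ x → Maybe.map strip (extract x ps)) (map proj₁ ps) ≡ map just (picks (map proj₂ ps))
extract-labels [] u = refl
extract-labels ((y , c) ∷ ps) (y∉ ∷ u) = cong₂ _∷_ here-eq (begin
  map (λ x → Maybe.map strip (extract x ((y , c) ∷ ps))) (map proj₁ ps)
    ≡⟨ map-cong-local (All.map (λ {x} → there-eq x) y∉) ⟩
  map (λ x → Maybe.map (map₂ (suc c ∷_)) (Maybe.map strip (extract x ps))) (map proj₁ ps)
    ≡⟨ map-∘ (map proj₁ ps) ⟩
  map (Maybe.map (map₂ (suc c ∷_))) (map (λ x → Maybe.map strip (extract x ps)) (map proj₁ ps))
    ≡⟨ cong (map (Maybe.map (map₂ (suc c ∷_)))) (extract-labels ps u) ⟩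
  map (Maybe.map (map₂ (suc c ∷_))) (map just (picks (map proj₂ ps)))
    ≡⟨ map-∘ (picks (map proj₂ ps)) ⟨
  map (λ p → just (map₂ (suc c ∷_) p)) (picks (map proj₂ ps))
    ≡⟨ map-∘ (picks (map proj₂ ps)) ⟩
  map just (map (map₂ (suc c ∷_)) (picks (map proj₂ ps))) ∎)
  where
  open ≡-Reasoning
  here-eq : Maybe.map strip (extract y ((y , c) ∷ ps)) ≡ just (c , map proj₂ ps)
  here-eq with y ≟ y
  ... | yes _ = refl
  ... | no ≢  = ⊥-elim (≢ refl)
  there-eq : ∀ x → y ≢ x → Maybe.map strip (extract x ((y , c) ∷ ps)) ≡
    Maybe.map (map₂ (suc c ∷_)) (Maybe.map strip (extract x ps))
  there-eq x y≢x with x ≟ y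
  ... | yes x≡y = ⊥-elim (y≢x (sym x≡y))
  ... | no _ with extract x ps
  ...   | nothing = refl
  ...   | just _  = refl

placeState : State → Maybe (ℕ × List ℕ) → State
placeState (v , cs) nothing  = v , 0 ∷ cs
placeState (v , cs) (just p) = attach v p

state-∷ : ∀ x w → state (x ∷ w) ≡ placeState (state w) (Maybe.map strip (extract x (entries w)))
state-∷ x w with extract x (entries w)
... | nothing = refl
... | just _  = refl

state-fresh : ∀ x w → x ∉ w → state (x ∷ w) ≡ (proj₁ (state w) , 0 ∷ proj₂ (state w))
state-fresh x w x∉ with prepend? x w
... | fresh _ eq rewrite eq = refl
... | moved P d Q split eq = ⊥-elim (x∉ (∈labels⇒∈ w (∈-split x split)))

-- The bridge between words and states: one fresh letter and each old label realise every successor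
-- once, in matching order.
successors-state : ∀ x w → x ∉ w → map (λ i → state (i ∷ w)) (x ∷ labels w) ≡ successors (state w)
successors-state x w x∉ = cong₂ _∷_ (state-fresh x w x∉) (begin
  map (λ i → state (i ∷ w)) (labels w)
    ≡⟨ map-cong (λ i → state-∷ i w) (labels w) ⟩
  map (λ i → placeState (state w) (Maybe.map strip (extract i (entries w)))) (labels w)
    ≡⟨ map-∘ (labels w) ⟩
  map (placeState (state w)) (map (λ i → Maybe.map strip (extract i (entries w))) (labels w))
    ≡⟨ cong (map (placeState (state w))) (extract-labels (entries w) (labels-unique w)) ⟩
  map (placeState (state w)) (map just (picks (proj₂ (state w))))
    ≡⟨ map-∘ (picks (proj₂ (state w))) ⟨
  map (attach (proj₁ (state w))) (picks (proj₂ (state w))) ∎)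
  where open ≡-Reasoning

-- Crossings of a word

≡ᵇ-refl : ∀ x → (x ≡ᵇ x) ≡ true
≡ᵇ-refl zero    = refl
≡ᵇ-refl (suc x) = ≡ᵇ-refl x

≢⇒≡ᵇ-false : ∀ x y → x ≢ y → (x ≡ᵇ y) ≡ false
≢⇒≡ᵇ-false zero    zero    ≢ = ⊥-elim (≢ refl)
≢⇒≡ᵇ-false zero    (suc y) ≢ = refl
≢⇒≡ᵇ-false (suc x) zero    ≢ = refl
≢⇒≡ᵇ-false (suc x) (suc y) ≢ = ≢⇒≡ᵇ-false x y λ e → ≢ (cong suc e)

indexOf-here : ∀ x xs → indexOf x (x ∷ xs) ≡ just 0
indexOf-here x xs rewrite ≡ᵇ-refl x = refl

indexOf-there : ∀ {x y} xs → x ≢ y → indexOf x (y ∷ xs) ≡ Maybe.map suc (indexOf x xs)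
indexOf-there {x} {y} xs x≢y rewrite ≢⇒≡ᵇ-false x y x≢y = refl

indexOf-∈ : ∀ {x} xs → x ∈ xs → ∃ λ p → indexOf x xs ≡ just p × p < length xs
indexOf-∈ {x} (y ∷ xs) x∈ with x ≟ y
... | yes refl = 0 , indexOf-here x xs , z<s
indexOf-∈ {x} (y ∷ xs) (here x≡y) | no x≢y = ⊥-elim (x≢y x≡y)
indexOf-∈ {x} (y ∷ xs) (there x∈) | no x≢y with indexOf-∈ xs x∈
... | p , eq , p< = suc p , trans (indexOf-there xs x≢y) (cong (Maybe.map suc) eq) , s<s p<

indexOf-∉ : ∀ {x} xs → x ∉ xs → indexOf x xs ≡ nothing
indexOf-∉ []       x∉ = refl
indexOf-∉ (y ∷ xs) x∉ = trans (indexOf-there xs λ e → x∉ (here e)) (cong (Maybe.map suc) (indexOf-∉ xs λ i → x∉ (there i)))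

just0≢map-suc : ∀ m → just 0 ≢ Maybe.map suc m
just0≢map-suc nothing  ()
just0≢map-suc (just _) ()

indexOf-injective : ∀ {x y} xs {p} → indexOf x xs ≡ just p → indexOf y xs ≡ just p → x ≡ y
indexOf-injective {x} {y} (z ∷ xs) ex ey with x ≟ z | y ≟ z
... | yes refl | yes refl = refl
... | yes refl | no y≢z   = ⊥-elim (just0≢map-suc (indexOf y xs) (trans (sym (indexOf-here x xs)) (trans (trans ex (sym ey)) (indexOf-there xs y≢z))))
... | no x≢z | yes refl = ⊥-elim (just0≢map-suc (indexOf x xs) (trans (sym (indexOf-here y xs)) (trans (trans ey (sym ex)) (indexOf-there xs x≢z))))
... | no x≢z | no y≢z with indexOf x xs in e₁ | indexOf y xs in e₂ | trans (sym (indexOf-there xs x≢z)) ex | trans (sym (indexOf-there xs y≢z)) ey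
...   | just p | just q | ex′ | ey′ = indexOf-injective xs e₁ (trans e₂ (cong just (suc-injective (just-injective (trans ey′ (sym ex′))))))
...   | nothing | _ | () | _
...   | just _ | nothing | _ | ()

shiftArc : ℕ × ℕ → ℕ × ℕ
shiftArc (i , j) = suc i , suc j

covers : ℕ → ℕ × ℕ → Bool
covers p (i , j) = (i <ᵇ p) ∧ (p <ᵇ j)

cover : ℕ → List (ℕ × ℕ) → ℕ
cover p A = length (filterᵇ (covers p) A)

arcs′-suc : ∀ i xs → arcs' (suc i) xs ≡ map shiftArc (arcs' i xs)
arcs′-suc i [] = refl
arcs′-suc i (x ∷ xs) with indexOf x xs
... | just d  = cong ((suc i , suc (i + suc d)) ∷_) (arcs′-suc (suc i) xs)
... | nothing = arcs′-suc (suc i) xs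

arcs-absent : ∀ x xs → indexOf x xs ≡ nothing → arcs (x ∷ xs) ≡ map shiftArc (arcs xs)
arcs-absent x xs eq rewrite eq = arcs′-suc 0 xs

arcs-present : ∀ x xs {p} → indexOf x xs ≡ just p → arcs (x ∷ xs) ≡ (0 , suc p) ∷ map shiftArc (arcs xs)
arcs-present x xs {p} eq rewrite eq = cong ((0 , suc p) ∷_) (arcs′-suc 0 xs)

length-filterᵇ-map : ∀ {A B : Set} (f : B → Bool) (g : A → B) xs →
  length (filterᵇ f (map g xs)) ≡ length (filterᵇ (λ x → f (g x)) xs)
length-filterᵇ-map f g []       = refl
length-filterᵇ-map f g (x ∷ xs) with f (g x)
... | true  = cong suc (length-filterᵇ-map f g xs)
... | false = length-filterᵇ-map f g xs

length-filterᵇ-++ : ∀ {A : Set} (f : A → Bool) xs ys →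
  length (filterᵇ f (xs ++ ys)) ≡ length (filterᵇ f xs) + length (filterᵇ f ys)
length-filterᵇ-++ f xs ys = trans (cong length (filter-++ _ xs ys)) (length-++ (filterᵇ f xs))

crossings : List (ℕ × ℕ) → List (ℕ × ℕ) → ℕ
crossings A B = length (filterᵇ crosses (cartesianProduct A B))

crossingsWith : ℕ × ℕ → List (ℕ × ℕ) → ℕ
crossingsWith a B = length (filterᵇ (λ b → crosses (a , b)) B)

crossings-∷ : ∀ a A B → crossings (a ∷ A) B ≡ crossingsWith a B + crossings A B
crossings-∷ a A B = trans (length-filterᵇ-++ crosses (map (a ,_) B) (cartesianProduct A B))
  (cong (_+ crossings A B) (length-filterᵇ-map crosses (a ,_) B))

crossings-shift : ∀ A B → crossings (map shiftArc A) (map shiftArc B) ≡ crossings A B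
crossings-shift []      B = refl
crossings-shift (a ∷ A) B = trans (crossings-∷ (shiftArc a) (map shiftArc A) (map shiftArc B))
  (trans (cong₂ _+_ (length-filterᵇ-map (λ b → crosses (shiftArc a , b)) shiftArc B) (crossings-shift A B)) (sym (crossings-∷ a A B)))

-- An arc that starts at position 0 cannot be the later-starting arc of a crossing.
crossings-0 : ∀ j A B → crossings A ((0 , j) ∷ B) ≡ crossings A B
crossings-0 j []      B = refl
crossings-0 j (a ∷ A) B = trans (crossings-∷ a A ((0 , j) ∷ B))
  (trans (cong (crossingsWith a B +_) (crossings-0 j A B)) (sym (crossings-∷ a A B)))

cr-absent : ∀ x xs → indexOf x xs ≡ nothing → cr (x ∷ xs) ≡ cr xs
cr-absent x xs eq = trans (cong (λ A → crossings A A) (arcs-absent x xs eq)) (crossings-shift (arcs xs) (arcs xs))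

-- The new arc ends at the old first occurrence of x, and it crosses exactly the old arcs that cover
-- this position.
cr-present : ∀ x xs {p} → indexOf x xs ≡ just p → cr (x ∷ xs) ≡ cr xs + cover p (arcs xs)
cr-present x xs {p} eq = begin
  cr (x ∷ xs)
    ≡⟨ cong (λ A → crossings A A) (arcs-present x xs eq) ⟩
  crossings ((0 , suc p) ∷ A) ((0 , suc p) ∷ A)
    ≡⟨ crossings-0 (suc p) ((0 , suc p) ∷ A) A ⟩
  crossings ((0 , suc p) ∷ A) A
    ≡⟨ crossings-∷ (0 , suc p) A A ⟩
  crossingsWith (0 , suc p) A + crossings A A
    ≡⟨ cong₂ _+_ (length-filterᵇ-map (λ b → crosses ((0 , suc p) , b)) shiftArc (arcs xs)) (crossings-shift (arcs xs) (arcs xs)) ⟩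
  cover p (arcs xs) + cr xs
    ≡⟨ +-comm (cover p (arcs xs)) (cr xs) ⟩
  cr xs + cover p (arcs xs) ∎
  where
  open ≡-Reasoning
  A = map shiftArc (arcs xs)

cover-shift : ∀ q A → cover (suc q) (map shiftArc A) ≡ cover q A
cover-shift q A = length-filterᵇ-map (covers (suc q)) shiftArc A

cover-0 : ∀ A → cover 0 A ≡ 0
cover-0 []      = refl
cover-0 (a ∷ A) = cover-0 A

<ᵇ-true : ∀ {m n} → m < n → (m <ᵇ n) ≡ true
<ᵇ-true {zero}  {suc n} _       = refl
<ᵇ-true {suc m} {suc n} (s<s p) = <ᵇ-true p

<ᵇ-false : ∀ {m n} → n ≤ m → (m <ᵇ n) ≡ false
<ᵇ-false {m}     {zero}  _       = refl
<ᵇ-false {suc m} {suc n} (s≤s p) = <ᵇ-false p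

-- The new arc covers the minima before the old minimum of its block and, by `cover-after`, none
-- from there on. This is the pattern `map suc X ++ Y` of `picks`.
cover-before : ∀ x xs {p q} → indexOf x xs ≡ just p → q < p → cover (suc q) (arcs (x ∷ xs)) ≡ suc (cover q (arcs xs))
cover-before x xs {p} {q} eq q<p rewrite arcs-present x xs eq | <ᵇ-true q<p = cong suc (cover-shift q (arcs xs))

cover-after : ∀ x xs {p q} → indexOf x xs ≡ just p → p ≤ q → cover (suc q) (arcs (x ∷ xs)) ≡ cover q (arcs xs)
cover-after x xs {p} {q} eq p≤q rewrite arcs-present x xs eq | <ᵇ-false p≤q = cover-shift q (arcs xs)

-- The index is a lower bound for the first occurrence of the first label; occurrences increase.
data Covered (w : List ℕ) : ℕ → Entries → Set where
  []  : ∀ {lb} → Covered w lb []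
  entry : ∀ {lb y p c ps} → indexOf y w ≡ just p → lb ≤ p → c ≡ cover p (arcs w) → Covered w (suc p) ps →
    Covered w lb ((y , c) ∷ ps)

Covered-weaken : ∀ {w lb lb′ ps} → lb′ ≤ lb → Covered w lb ps → Covered w lb′ ps
Covered-weaken le []                 = []
Covered-weaken le (entry i l c cov) = entry i (≤-trans le l) c cov

indexOf-shift : ∀ {x y p} xs → y ≢ x → indexOf y xs ≡ just p → indexOf y (x ∷ xs) ≡ just (suc p)
indexOf-shift xs y≢x eq = trans (indexOf-there xs y≢x) (cong (Maybe.map suc) eq)

Covered-absent : ∀ {x xs lb ps} → indexOf x xs ≡ nothing → Covered xs lb ps → Covered (x ∷ xs) (suc lb) ps
Covered-absent eq [] = []
Covered-absent {x} {xs} eq (entry {p = p} i l c cov) =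
  entry (indexOf-shift xs (λ { refl → case trans (sym eq) i of λ () }) i) (s≤s l)
    (trans c (sym (trans (cong (cover (suc p)) (arcs-absent x xs eq)) (cover-shift p (arcs xs)))))
    (Covered-absent eq cov)

Covered-after : ∀ {x xs p lb ps} → indexOf x xs ≡ just p → p < lb → Covered xs lb ps → Covered (x ∷ xs) (suc lb) ps
Covered-after eq lt [] = []
Covered-after {x} {xs} {p} eq lt (entry i l c cov) =
  entry (indexOf-shift xs (λ { refl → <⇒≢ (<-≤-trans lt l) (just-injective (trans (sym eq) i)) }) i) (s≤s l)
    (trans c (sym (cover-after x xs eq (<⇒≤ (<-≤-trans lt l)))))
    (Covered-after eq (≤-trans lt (m≤n⇒m≤1+n l)) cov)

-- The bound lb ≤ p is returned so that each entry of P is known to occur strictly before p, where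
-- the new arc adds one to its count.
Covered-moved : ∀ {x xs p lb} P d Q → indexOf x xs ≡ just p → Covered xs lb (P ++ (x , d) ∷ Q) →
  d ≡ cover p (arcs xs) × lb ≤ p × Covered (x ∷ xs) (suc lb) (map (map₂ suc) P ++ Q)
Covered-moved [] d Q eq (entry i l c cov) with just-injective (trans (sym eq) i)
... | refl = c , l , Covered-weaken (s≤s (m≤n⇒m≤1+n l)) (Covered-after eq ≤-refl cov)
Covered-moved {x} {xs} ((y , c′) ∷ P) d Q eq (entry i l c cov) with Covered-moved P d Q eq cov
... | d≡ , q<p , cov′ = d≡ , ≤-trans l (<⇒≤ q<p) ,
  entry (indexOf-shift xs (λ { refl → <⇒≢ q<p (just-injective (trans (sym i) eq)) }) i) (s≤s l)
    (trans (cong suc c) (sym (cover-before x xs eq q<p))) cov′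

profile-correct : ∀ w → cr w ≡ proj₁ (profile w) × Covered w 0 (entries w)
profile-correct [] = refl , []
profile-correct (x ∷ w) with profile-correct w | prepend? x w
... | v≡ , cov | fresh x∉ eq rewrite eq = trans (cr-absent x w ind) v≡
  , entry (indexOf-here x w) z≤n (sym (cover-0 (arcs (x ∷ w)))) (Covered-absent ind cov)
  where ind = indexOf-∉ w λ x∈ → x∉ (∈⇒∈labels w x∈)
... | v≡ , cov | moved P d Q split eq with indexOf-∈ w (∈labels⇒∈ w (∈-split x split))
...   | p , ind , _ with Covered-moved P d Q ind (subst (Covered w 0) split cov)
...     | d≡ , _ , cov′ rewrite eq = trans (cr-present x w ind) (cong₂ _+_ v≡ (sym d≡))
  , entry (indexOf-here x w) z≤n (sym (cover-0 (arcs (x ∷ w)))) cov′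

cr≡ : ∀ w → cr w ≡ proj₁ (state w)
cr≡ w = proj₁ (profile-correct w)

-- Standardisation and the tree of partitions

Unique-↭ : ∀ {A : Set} {xs ys : List A} → Unique xs → Unique ys →
  (∀ {x} → x ∈ xs → x ∈ ys) → (∀ {x} → x ∈ ys → x ∈ xs) → xs ↭ ys
Unique-↭ u v f g = ∼bag⇒↭ (unique∧set⇒bag u v (mk⇔ f g))

indexOf-++ˡ : ∀ {x p} xs ys → indexOf x xs ≡ just p → indexOf x (xs ++ ys) ≡ just p
indexOf-++ˡ {x} (y ∷ xs) ys eq with x ≟ y
... | yes refl = trans (indexOf-here x (xs ++ ys)) (trans (sym (indexOf-here x xs)) eq)
... | no x≢y with indexOf x xs in e | trans (sym (indexOf-there xs x≢y)) eq
...   | just q | refl = indexOf-shift (xs ++ ys) x≢y (indexOf-++ˡ xs ys e)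

indexOf-++ʳ : ∀ {x} xs ys → x ∉ xs → indexOf x (xs ++ x ∷ ys) ≡ just (length xs)
indexOf-++ʳ {x} []       ys x∉ = indexOf-here x ys
indexOf-++ʳ {x} (y ∷ xs) ys x∉ =
  indexOf-shift (xs ++ x ∷ ys) (λ e → x∉ (here e)) (indexOf-++ʳ xs ys λ i → x∉ (there i))

indexOf-just : ∀ {x p} xs → indexOf x xs ≡ just p → x ∈ xs × p < length xs
indexOf-just {x} xs eq with x ∈? xs
... | no x∉ = case trans (sym eq) (indexOf-∉ xs x∉) of λ ()
... | yes x∈ with indexOf-∈ xs x∈
...   | p , eq′ , p< with just-injective (trans (sym eq) eq′)
...     | refl = x∈ , p<

indexOf-nothing : ∀ {x} xs → indexOf x xs ≡ nothing → x ∉ xs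
indexOf-nothing xs eq x∈ with indexOf-∈ xs x∈
... | p , eq′ , _ = case trans (sym eq) eq′ of λ ()

-- The default 0 is never reached for letters of a standardised word, because all of them occur in
-- the list of seen labels.
index : List ℕ → ℕ → ℕ
index L x = Maybe.fromMaybe 0 (indexOf x L)

-- The list of seen labels only grows at its end, so each index assigned on the way is already the
-- index in the final list. Standardisation is thus a single relabelling.
std′-map : ∀ seen w → ∃ λ extra →
  std' seen w ≡ map (index (seen ++ extra)) w × (∀ {x} → x ∈ w → x ∈ seen ++ extra)
std′-map seen [] = [] , refl , λ ()
std′-map seen (x ∷ w) with indexOf x seen in eq
... | just i with std′-map seen w
...   | extra , e , sub = extra , cong₂ _∷_ (sym (cong (Maybe.fromMaybe 0) (indexOf-++ˡ seen extra eq))) e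
  , λ { (here refl) → ∈-++⁺ˡ (proj₁ (indexOf-just seen eq)) ; (there i∈) → sub i∈ }
std′-map seen (x ∷ w) | nothing with std′-map (seen ++ [ x ]) w
...   | extra , e , sub rewrite ++-assoc seen [ x ] extra = x ∷ extra
  , cong₂ _∷_ (sym (cong (Maybe.fromMaybe 0) (indexOf-++ʳ seen extra (indexOf-nothing seen eq)))) e
  , λ { (here refl) → ∈-++⁺ʳ seen (here refl) ; (there i∈) → sub i∈ }

std-map : ∀ w → ∃ λ f → InjOn f w × std w ≡ map f w
std-map w with std′-map [] w
... | L , e , sub = index L , inj , e
  where
  inj : InjOn (index L) w
  inj x∈ y∈ eq with indexOf-∈ L (sub x∈) | indexOf-∈ L (sub y∈)
  ... | p , ep , _ | q , eq′ , _ rewrite ep | eq′ = indexOf-injective L ep (trans eq′ (cong just (sym eq)))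

indexOf-map : ∀ {f x} xs → InjOn f (x ∷ xs) → indexOf (f x) (map f xs) ≡ indexOf x xs
indexOf-map []       inj = refl
indexOf-map {f} {x} (y ∷ xs) inj with x ≟ y
... | yes refl = trans (indexOf-here (f x) (map f xs)) (sym (indexOf-here x xs))
... | no x≢y = trans (indexOf-there (map f xs) λ e → x≢y (inj (here refl) (there (here refl)) e))
  (trans (cong (Maybe.map suc) (indexOf-map xs (InjOn-⊆ (λ { (here e) → here e ; (there i) → there (there i) }) inj)))
         (sym (indexOf-there xs x≢y)))

std′-invariant : ∀ {f} seen w → InjOn f (seen ++ w) → std' (map f seen) (map f w) ≡ std' seen w
std′-invariant seen [] inj = refl
std′-invariant {f} seen (x ∷ w) inj
  rewrite indexOf-map {f} {x} seen (InjOn-⊆ (λ { (here refl) → ∈-++⁺ʳ seen (here refl) ; (there i) → ∈-++⁺ˡ i }) inj)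
  with indexOf x seen
... | just i  = cong (i ∷_) (std′-invariant seen w (InjOn-⊆ sub inj))
  where
  sub : ∀ {y} → y ∈ seen ++ w → y ∈ seen ++ x ∷ w
  sub y∈ with ∈-++⁻ seen y∈
  ... | inj₁ l = ∈-++⁺ˡ l
  ... | inj₂ r = ∈-++⁺ʳ seen (there r)
... | nothing = cong₂ _∷_ (length-map f seen) (trans (cong (λ s → std' s (map f w)) (sym (map-++ f seen [ x ])))
  (std′-invariant (seen ++ [ x ]) w (subst (InjOn f) (sym (++-assoc seen [ x ] w)) inj)))

std-invariant : ∀ {f} w → InjOn f w → std (map f w) ≡ std w
std-invariant w inj = std′-invariant [] w inj

length-std : ∀ w → length (std w) ≡ length w
length-std w with std-map w
... | f , inj , e = trans (cong length e) (length-map f w)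

Canonical : List ℕ → Set
Canonical w = std w ≡ w

std-canonical : ∀ w → Canonical (std w)
std-canonical w with std-map w
... | f , inj , e = trans (cong std e) (std-invariant w inj)

std-drop-std : ∀ l w → std (drop l (std w)) ≡ std (drop l w)
std-drop-std l w with std-map w
... | f , inj , e = trans (cong (λ u → std (drop l u)) e) (trans (cong std (drop-map l w))
  (std-invariant (drop l w) (InjOn-⊆ (drop-⊆ l w) inj)))
  where
  drop-⊆ : ∀ l w {x : ℕ} → x ∈ drop l w → x ∈ w
  drop-⊆ zero    w       x∈ = x∈
  drop-⊆ (suc l) (x ∷ w) x∈ = there (drop-⊆ l w x∈)

state-std : ∀ w → state (std w) ≡ state w
state-std w with std-map w
... | f , inj , e = trans (cong state e) (state-map f w inj)

-- Restricted growth strings and the enumeration `Π`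

data Growth : ℕ → List ℕ → Set where
  []  : ∀ {b} → Growth b []
  old : ∀ {b x w} → x < b → Growth b w → Growth b (x ∷ w)
  new : ∀ {b w} → Growth (suc b) w → Growth b (b ∷ w)

std′-growth : ∀ seen w → Growth (length seen) (std' seen w)
std′-growth seen [] = []
std′-growth seen (x ∷ w) with indexOf x seen in eq
... | just i  = old (proj₂ (indexOf-just seen eq)) (std′-growth seen w)
... | nothing = new (subst (λ b → Growth b (std' (seen ++ [ x ]) w))
  (trans (length-++ seen) (+-comm _ 1)) (std′-growth (seen ++ [ x ]) w))

indexOf-upTo : ∀ {x} b → x < b → indexOf x (upTo b) ≡ just x
indexOf-upTo {x} (suc b) (s<s x≤b) = trans (cong (indexOf x) (sym (upTo-∷ʳ b))) (last (m≤n⇒m<n∨m≡n x≤b))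
  where
  last : x < b ⊎ x ≡ b → indexOf x (upTo b ++ [ b ]) ≡ just x
  last (inj₁ x<b)  = indexOf-++ˡ (upTo b) [ b ] (indexOf-upTo b x<b)
  last (inj₂ refl) = trans (indexOf-++ʳ (upTo x) [] (λ x∈ → <-irrefl refl (∈-upTo⁻ x∈))) (cong just (length-upTo x))

growth⇒std′ : ∀ {b w} → Growth b w → std' (upTo b) w ≡ w
growth⇒std′ []                   = refl
growth⇒std′ {b} (old {x = x} x<b g) rewrite indexOf-upTo b x<b = cong (x ∷_) (growth⇒std′ g)
growth⇒std′ {b} (new g)
  rewrite indexOf-∉ {b} (upTo b) (λ b∈ → <-irrefl refl (∈-upTo⁻ b∈)) | upTo-∷ʳ b | length-upTo b
  = cong (b ∷_) (growth⇒std′ g)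

bound : ℕ → ℕ → ℕ
bound b x = if x ≡ᵇ b then suc b else b

∈-ext⁻ : ∀ b r {w} → w ∈ ext b r → Growth b w × length w ≡ r
∈-ext⁻ b zero    (here refl) = [] , refl
∈-ext⁻ b (suc r) w∈ with ∈-concatMap⁻ (λ x → map (x ∷_) (ext (bound b x) r)) {xs = upTo (suc b)} w∈
... | w∈′ with find w∈′
... | x , x∈ , w∈″ with ∈-map⁻ (x ∷_) w∈″
... | u , u∈ , refl with ∈-ext⁻ (bound b x) r u∈ | x ≟ b
...   | g , e | yes refl rewrite ≡ᵇ-refl x = new g , cong suc e
...   | g , e | no x≢b rewrite ≢⇒≡ᵇ-false x b x≢b = old (≤∧≢⇒< (s≤s⁻¹ (∈-upTo⁻ x∈)) x≢b) g , cong suc e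

∈-ext⁺ : ∀ {b w} → Growth b w → w ∈ ext b (length w)
∈-ext⁺ [] = here refl
∈-ext⁺ {b} (old {x = x} {w = w} x<b g) =
  ∈-concatMap⁺ (λ x → map (x ∷_) (ext (bound b x) (length w)))
    (lose (∈-upTo⁺ (m<n⇒m<1+n x<b)) (∈-map⁺ (x ∷_)
      (subst (λ c → w ∈ ext c (length w)) (cong (λ t → if t then suc b else b) (sym (≢⇒≡ᵇ-false x b (<⇒≢ x<b)))) (∈-ext⁺ g))))
∈-ext⁺ {b} (new {w = w} g) =
  ∈-concatMap⁺ (λ x → map (x ∷_) (ext (bound b x) (length w)))
    (lose (∈-upTo⁺ (n<1+n b)) (∈-map⁺ (b ∷_)
      (subst (λ c → w ∈ ext c (length w)) (cong (λ t → if t then suc b else b) (sym (≡ᵇ-refl b))) (∈-ext⁺ g))))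

concatMap-unique : ∀ {A B : Set} (f : A → List B) {xs} → Unique xs → (∀ {x} → x ∈ xs → Unique (f x)) →
  (∀ {x y z} → x ∈ xs → y ∈ xs → z ∈ f x → z ∈ f y → x ≡ y) → Unique (concatMap f xs)
concatMap-unique f [] uf dis = []
concatMap-unique f {x ∷ xs} (x∉ ∷ u) uf dis = Uniq.++⁺ (uf (here refl))
  (concatMap-unique f u (λ i → uf (there i)) (λ i j → dis (there i) (there j)))
  λ (z∈x , z∈) → let y , y∈ , z∈y = find (∈-concatMap⁻ f z∈) in
    All.lookup x∉ y∈ (dis (here refl) (there y∈) z∈x z∈y)

ext-unique : ∀ b r → Unique (ext b r)
ext-unique b zero    = [] ∷ []
ext-unique b (suc r) = concatMap-unique (λ x → map (x ∷_) (ext (bound b x) r)) (Uniq.upTo⁺ (suc b))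
  (λ {x} _ → Uniq.map⁺ ∷-injectiveʳ (ext-unique (bound b x) r))
  λ {x} {y} _ _ z∈x z∈y → let _ , _ , e = ∈-map⁻ (x ∷_) z∈x ; _ , _ , e′ = ∈-map⁻ (y ∷_) z∈y in
    ∷-injectiveˡ (trans (sym e) e′)

∈Π⇒ : ∀ {n w} → w ∈ Π n → Canonical w × length w ≡ n
∈Π⇒ {n} w∈ with ∈-ext⁻ 0 n w∈
... | g , e = growth⇒std′ g , e

canonical⇒growth : ∀ {w} → Canonical w → Growth 0 w
canonical⇒growth {w} c = subst (Growth 0) c (std′-growth [] w)

∈Π⁺ : ∀ {w} → Canonical w → w ∈ Π (length w)
∈Π⁺ c = ∈-ext⁺ (canonical⇒growth c)

∈⇒<nblocks : ∀ {x} w → x ∈ w → x < nblocks w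
∈⇒<nblocks (y ∷ w) (here refl) = m≤n⊔m (nblocks w) (suc y)
∈⇒<nblocks (y ∷ w) (there x∈)  = ≤-trans (∈⇒<nblocks w x∈) (m≤m⊔n (nblocks w) (suc y))

growth-onto : ∀ {b x w} → Growth b w → b ≤ x → x < nblocks w → x ∈ w
growth-onto {b} {x} (old {x = y} {w = w} y<b g) b≤x x< with ⊔-sel (nblocks w) (suc y)
... | inj₁ e = there (growth-onto g b≤x (subst (x <_) e x<))
... | inj₂ e = ⊥-elim (<-irrefl refl (<-≤-trans (subst (x <_) e x<) (≤-trans y<b b≤x)))
growth-onto {b} {x} (new {w = w} g) b≤x x< with m≤n⇒m<n∨m≡n b≤x
... | inj₂ refl = here refl
... | inj₁ b<x with ⊔-sel (nblocks w) (suc b)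
...   | inj₁ e = there (growth-onto g b<x (subst (x <_) e x<))
...   | inj₂ e = ⊥-elim (<-irrefl refl (<-≤-trans (subst (x <_) e x<) b<x))

-- `nblocks` is one more than the largest letter; restricted growth skips no letter, so this is the
-- number of labels.
nblocks≡ : ∀ {w} → Canonical w → nblocks w ≡ length (proj₂ (state w))
nblocks≡ {w} c = begin
  nblocks w                 ≡⟨ length-upTo (nblocks w) ⟨
  length (upTo (nblocks w)) ≡⟨ Perm.↭-length (Unique-↭ (Uniq.upTo⁺ (nblocks w)) (labels-unique w)
    (λ x∈ → ∈⇒∈labels w (growth-onto (canonical⇒growth c) z≤n (∈-upTo⁻ x∈)))
    (λ x∈ → ∈-upTo⁺ (∈⇒<nblocks w (∈labels⇒∈ w x∈)))) ⟩
  length (labels w)         ≡⟨ length-map proj₁ (entries w) ⟩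
  length (entries w)        ≡⟨ length-map proj₂ (entries w) ⟨
  length (proj₂ (state w))  ∎
  where open ≡-Reasoning

-- Descendants as iterated children

fresh∉ : ∀ w → nblocks w ∉ w
fresh∉ w n∈ = <-irrefl refl (∈⇒<nblocks w n∈)

-- `nblocks ν` exceeds all letters of ν and so stands for a new block; `std` then restores the
-- canonical numbering.
childWords : List ℕ → List (List ℕ)
childWords ν = map (λ i → std (i ∷ ν)) (nblocks ν ∷ labels ν)

descendantWords : List ℕ → ℕ → List (List ℕ)
descendantWords ν zero    = ν ∷ []
descendantWords ν (suc l) = concatMap childWords (descendantWords ν l)

Restricts : List ℕ → ℕ → List ℕ → Set
Restricts ν l μ = Canonical μ × length μ ≡ l + length ν × std (drop l μ) ≡ ν

∈childWords⁻ : ∀ {ν μ} → μ ∈ childWords ν → ∃ λ i → μ ≡ std (i ∷ ν)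
∈childWords⁻ {ν} μ∈ with ∈-map⁻ (λ i → std (i ∷ ν)) μ∈
... | i , _ , e = i , e

∈descendantWords⁻ : ∀ {ν} l {μ} → Canonical ν → μ ∈ descendantWords ν l → Restricts ν l μ
∈descendantWords⁻ zero c (here refl) = c , refl , c
∈descendantWords⁻ {ν} (suc l) c μ∈ with find (∈-concatMap⁻ childWords {xs = descendantWords ν l} μ∈)
... | κ , κ∈ , μ∈′ with ∈childWords⁻ {κ} μ∈′ | ∈descendantWords⁻ l c κ∈
...   | i , refl | cκ , len , r = std-canonical (i ∷ κ) , trans (length-std (i ∷ κ)) (cong suc len)
  , trans (std-drop-std (suc l) (i ∷ κ)) r

∈childWords⁺ : ∀ {x w} → Canonical (x ∷ w) → x ∷ w ∈ childWords (std w)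
∈childWords⁺ {x} {w} c with std-map w
... | f , inj , e rewrite e with x ∈? w
...   | yes x∈ = subst (_∈ childWords (map f w)) (trans (std-invariant (x ∷ w) inj′) c)
  (∈-map⁺ (λ i → std (i ∷ map f w)) (there (∈⇒∈labels (map f w) (∈-map⁺ f x∈))))
  where
  inj′ : InjOn f (x ∷ w)
  inj′ = InjOn-⊆ (λ { (here refl) → x∈ ; (there i) → i }) inj
...   | no x∉ = subst (_∈ childWords (map f w)) (trans (cong std (sym image)) (trans (std-invariant (x ∷ w) inj′) c)) (here refl)
  where
  k : ℕ
  k = nblocks (map f w)
  -- Outside w the map f is uncontrolled and may send x to a letter already taken, so its value at x
  -- is redefined to be fresh.
  f′ : ℕ → ℕ
  f′ y = if x ≡ᵇ y then k else f y
  f′-x : f′ x ≡ k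
  f′-x rewrite ≡ᵇ-refl x = refl
  f′-∈ : ∀ {y} → y ∈ w → f′ y ≡ f y
  f′-∈ {y} y∈ rewrite ≢⇒≡ᵇ-false x y (λ { refl → x∉ y∈ }) = refl
  image : map f′ (x ∷ w) ≡ k ∷ map f w
  image = cong₂ _∷_ f′-x (map-cong-local (All.tabulate f′-∈))
  k≢f : ∀ {y} → y ∈ w → k ≢ f y
  k≢f y∈ e′ = fresh∉ (map f w) (subst (_∈ map f w) (sym e′) (∈-map⁺ f y∈))
  inj′ : InjOn f′ (x ∷ w)
  inj′ (here refl) (here refl) _  = refl
  inj′ (here refl) (there y∈)  eq = ⊥-elim (k≢f y∈ (trans (sym f′-x) (trans eq (f′-∈ y∈))))
  inj′ (there y∈)  (here refl) eq = ⊥-elim (k≢f y∈ (trans (sym f′-x) (trans (sym eq) (f′-∈ y∈))))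
  inj′ (there y∈)  (there z∈)  eq = inj y∈ z∈ (trans (sym (f′-∈ y∈)) (trans eq (f′-∈ z∈)))

∈descendantWords⁺ : ∀ {ν} l {μ} → Restricts ν l μ → μ ∈ descendantWords ν l
∈descendantWords⁺ zero (c , _ , r) = here (trans (sym c) r)
∈descendantWords⁺ {ν} (suc l) {x ∷ w} (c , len , r) = ∈-concatMap⁺ childWords
  (lose (∈descendantWords⁺ l (std-canonical w , trans (length-std w) (suc-injective len) , trans (std-drop-std l w) r))
        (∈childWords⁺ c))

-- Equal results force the two relabellings to agree on w, hence at i. Equal heads then give g i ≡ g
-- j, and g is injective. One old label suffices, so the comparison with the fresh label is
-- included.
std-∷-injective : ∀ {i j} w → i ∈ w → std (i ∷ w) ≡ std (j ∷ w) → i ≡ j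
std-∷-injective {i} {j} w i∈ eq with std-map (i ∷ w) | std-map (j ∷ w)
... | f , _ , ef | g , inj , eg = inj (there i∈) (here refl)
  (trans (sym (agree w (∷-injectiveʳ eq′) i∈)) (∷-injectiveˡ eq′))
  where
  eq′ : map f (i ∷ w) ≡ map g (j ∷ w)
  eq′ = trans (sym ef) (trans eq eg)
  agree : ∀ {y} u → map f u ≡ map g u → y ∈ u → f y ≡ g y
  agree (z ∷ u) e (here refl) = ∷-injectiveˡ e
  agree (z ∷ u) e (there y∈)  = agree u (∷-injectiveʳ e) y∈

childWords-unique : ∀ ν → Unique (childWords ν)
childWords-unique ν = distinct (Allₚ.¬Any⇒All¬ _ (λ n∈ → fresh∉ ν (∈labels⇒∈ ν n∈)) ∷ labels-unique ν) (All.tabulate (∈labels⇒∈ ν))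
  where
  distinct : ∀ {i is} → Unique (i ∷ is) → All (_∈ ν) is → Unique (map (λ i → std (i ∷ ν)) (i ∷ is))
  distinct (_ ∷ []) [] = [] ∷ []
  distinct (i∉ ∷ u) (j∈ ∷ is⊆) = Allₚ.map⁺ (All.zipWith (λ (i≢j , j∈) e → i≢j (sym (std-∷-injective ν j∈ (sym e)))) (i∉ , j∈ ∷ is⊆))
    ∷ distinct u is⊆

-- A child determines its parent, which is the standardisation of its tail, so different parents
-- share no child.
descendantWords-unique : ∀ {ν} l → Canonical ν → Unique (descendantWords ν l)
descendantWords-unique zero    c = [] ∷ []
descendantWords-unique {ν} (suc l) c = concatMap-unique childWords (descendantWords-unique l c) (λ {κ} _ → childWords-unique κ)
  λ κ∈ κ′∈ z∈ z∈′ → trans (sym (parent κ∈ z∈)) (parent κ′∈ z∈′)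
  where
  parent : ∀ {κ μ} → κ ∈ descendantWords ν l → μ ∈ childWords κ → std (drop 1 μ) ≡ κ
  parent {κ} κ∈ μ∈ with ∈childWords⁻ {κ} μ∈
  ... | i , refl = trans (std-drop-std 1 (i ∷ κ)) (proj₁ (∈descendantWords⁻ l c κ∈))

listEqᵇ-sound : ∀ xs ys → T (listEqᵇ xs ys) → xs ≡ ys
listEqᵇ-sound []       []       _ = refl
listEqᵇ-sound (x ∷ xs) (y ∷ ys) t with Equivalence.to (T-∧ {x ≡ᵇ y}) t
... | tx , txs = cong₂ _∷_ (≡ᵇ⇒≡ x y tx) (listEqᵇ-sound xs ys txs)

listEqᵇ-refl : ∀ xs → T (listEqᵇ xs xs)
listEqᵇ-refl []       = _
listEqᵇ-refl (x ∷ xs) = Equivalence.from (T-∧ {x ≡ᵇ x}) (≡⇒≡ᵇ x x refl , listEqᵇ-refl xs)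

-- Multiplicities matter in the relation, so besides having the same members both lists must be free
-- of repetitions.
Tdesc-↭ : ∀ {ν} l m → Canonical ν → Tdesc ν l m ↭ filterᵇ (λ μ → nblocks μ ≡ᵇ m) (descendantWords ν l)
Tdesc-↭ {ν} l m c = Unique-↭ (Uniq.filter⁺ _ (ext-unique 0 (l + length ν))) (Uniq.filter⁺ _ (descendantWords-unique l c)) to from
  where
  to : ∀ {μ} → μ ∈ Tdesc ν l m → μ ∈ filterᵇ (λ μ → nblocks μ ≡ᵇ m) (descendantWords ν l)
  to {μ} μ∈ with ∈-filter⁻ (λ μ → T? (listEqᵇ (std (drop l μ)) ν ∧ (nblocks μ ≡ᵇ m))) {xs = Π (l + length ν)} μ∈
  ... | μ∈Π , t with ∈Π⇒ μ∈Π | Equivalence.to (T-∧ {listEqᵇ (std (drop l μ)) ν}) t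
  ...   | cμ , len | t₁ , t₂ = ∈-filter⁺ (λ μ → T? (nblocks μ ≡ᵇ m)) (∈descendantWords⁺ l (cμ , len , listEqᵇ-sound _ _ t₁)) t₂
  from : ∀ {μ} → μ ∈ filterᵇ (λ μ → nblocks μ ≡ᵇ m) (descendantWords ν l) → μ ∈ Tdesc ν l m
  from {μ} μ∈ with ∈-filter⁻ (λ μ → T? (nblocks μ ≡ᵇ m)) {xs = descendantWords ν l} μ∈
  ... | μ∈D , t with ∈descendantWords⁻ l c μ∈D
  ...   | cμ , len , r = ∈-filter⁺ (λ μ → T? (listEqᵇ (std (drop l μ)) ν ∧ (nblocks μ ≡ᵇ m)))
    (subst (λ n → μ ∈ Π n) len (∈Π⁺ cμ))
    (Equivalence.from (T-∧ {listEqᵇ (std (drop l μ)) ν}) (subst (λ u → T (listEqᵇ u ν)) (sym r) (listEqᵇ-refl ν) , t))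

concatMap-concatMap : ∀ {A B C : Set} (g : B → List C) (f : A → List B) xs →
  concatMap g (concatMap f xs) ≡ concatMap (λ x → concatMap g (f x)) xs
concatMap-concatMap g f []       = refl
concatMap-concatMap g f (x ∷ xs) = trans (concatMap-++ g (f x) (concatMap f xs)) (cong (concatMap g (f x) ++_) (concatMap-concatMap g f xs))

-- `descendants` unfolds the first step, as the weighted count needs, whereas `descendantWords`
-- unfolds the last one.
descendants-suc : ∀ l s → descendants (suc l) s ≡ concatMap successors (descendants l s)
descendants-suc zero    s = trans (concatMap-pure (successors s)) (sym (++-identityʳ (successors s)))
descendants-suc (suc l) s = trans (concatMap-cong (descendants-suc l) (successors s))
  (sym (concatMap-concatMap successors (descendants l) (successors s)))

state-childWords : ∀ ν → map state (childWords ν) ≡ successors (state ν)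
state-childWords ν = trans (sym (map-∘ (nblocks ν ∷ labels ν)))
  (trans (map-cong (λ i → state-std (i ∷ ν)) (nblocks ν ∷ labels ν)) (successors-state (nblocks ν) ν (fresh∉ ν)))

state-descendantWords : ∀ ν l → map state (descendantWords ν l) ≡ descendants l (state ν)
state-descendantWords ν zero    = refl
state-descendantWords ν (suc l) = begin
  map state (concatMap childWords (descendantWords ν l))
    ≡⟨ map-concatMap state childWords (descendantWords ν l) ⟩
  concatMap (λ κ → map state (childWords κ)) (descendantWords ν l)
    ≡⟨ concatMap-cong state-childWords (descendantWords ν l) ⟩
  concatMap (λ κ → successors (state κ)) (descendantWords ν l)
    ≡⟨ concatMap-map successors state (descendantWords ν l) ⟨
  concatMap successors (map state (descendantWords ν l))
    ≡⟨ cong (concatMap successors) (state-descendantWords ν l) ⟩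
  concatMap successors (descendants l (state ν))
    ≡⟨ descendants-suc l (state ν) ⟨
  descendants (suc l) (state ν) ∎
  where open ≡-Reasoning

values-state : ∀ m ws → All Canonical ws → map cr (filterᵇ (λ μ → nblocks μ ≡ᵇ m) ws) ≡ values m (map state ws)
values-state m [] [] = refl
values-state m (w ∷ ws) (c ∷ cs) rewrite nblocks≡ c with length (proj₂ (state w)) ≡ᵇ m
... | true  = cong₂ _∷_ (cr≡ w) (values-state m ws cs)
... | false = values-state m ws cs

Tdesc-values : ∀ {ν} l m → Canonical ν → map cr (Tdesc ν l m) ↭ values m (descendants l (state ν))
Tdesc-values {ν} l m c = ↭-trans (Perm.map⁺ cr (Tdesc-↭ l m c))
  (subst (map cr (filterᵇ (λ μ → nblocks μ ≡ᵇ m) (descendantWords ν l)) ↭_)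
    (trans (values-state m (descendantWords ν l) (All.tabulate λ μ∈ → proj₁ (∈descendantWords⁻ l c μ∈)))
           (cong (values m) (state-descendantWords ν l)))
    ↭-refl)

-- Crossing similarity in terms of states

∼cr⁺ : ∀ {ν π} → Canonical ν → Canonical π → proj₁ (state ν) ≡ proj₁ (state π) →
  proj₂ (state ν) ↭ proj₂ (state π) → ν ∼cr π
∼cr⁺ {ν} {π} cν cπ v≡ cs↭ l m = ↭-trans (Tdesc-values l m cν)
  (↭-trans (subst (λ v → values m (descendants l (state ν)) ↭ values m (descendants l (v , proj₂ (state π)))) v≡
             (values-descendants-↭ l m (proj₁ (state ν)) cs↭))
           (↭-sym (Tdesc-values l m cπ)))

map-proj₁-picks : ∀ cs → map proj₁ (picks cs) ≡ cs
map-proj₁-picks []       = refl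
map-proj₁-picks (c ∷ cs) = cong (c ∷_) (trans (sym (map-∘ (picks cs))) (map-proj₁-picks cs))

length-picks : ∀ cs → All (λ p → suc (length (proj₂ p)) ≡ length cs) (picks cs)
length-picks []       = []
length-picks (c ∷ cs) = refl ∷ Allₚ.map⁺ (All.map (cong suc) (length-picks cs))

values-all : ∀ m {ss} → All (λ s → length (proj₂ s) ≡ m) ss → values m ss ≡ map proj₁ ss
values-all m [] = refl
values-all m {s ∷ ss} (refl ∷ es) rewrite ≡ᵇ-refl (length (proj₂ s)) = cong (proj₁ s ∷_) (values-all m es)

values-descendants-0 : ∀ v cs → values (length cs) (descendants 0 (v , cs)) ≡ v ∷ []
values-descendants-0 v cs = values-all (length cs) {(v , cs) ∷ []} (refl ∷ [])

-- Asking for the original number of blocks rejects the child that opens a block; attaching to block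
-- i yields v plus its count.
values-descendants-1 : ∀ v cs → values (length cs) (descendants 1 (v , cs)) ≡ map (v +_) cs
values-descendants-1 v cs
  rewrite concatMap-pure (map (attach v) (picks cs)) | ≢⇒≡ᵇ-false (suc (length cs)) (length cs) 1+n≢n = begin
  values (length cs) (map (attach v) (picks cs))  ≡⟨ values-all (length cs) (Allₚ.map⁺ (length-picks cs)) ⟩
  map proj₁ (map (attach v) (picks cs))           ≡⟨ map-∘ (picks cs) ⟨
  map (λ p → v + proj₁ p) (picks cs)              ≡⟨ map-∘ (picks cs) ⟩
  map (v +_) (map proj₁ (picks cs))               ≡⟨ cong (map (v +_)) (map-proj₁-picks cs) ⟩
  map (v +_) cs                                   ∎
  where open ≡-Reasoning

↭-map⁻ : ∀ (f g : ℕ → ℕ) → (∀ x → g (f x) ≡ x) → ∀ {xs ys} → map f xs ↭ map f ys → xs ↭ ys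
↭-map⁻ f g gf {xs} {ys} p = subst₂ _↭_ (back xs) (back ys) (Perm.map⁺ g p)
  where
  back : ∀ zs → map g (map f zs) ≡ zs
  back zs = trans (sym (map-∘ zs)) (trans (map-cong gf zs) (map-id zs))

∼cr⁻ : ∀ {ν π} → Canonical ν → Canonical π → length (proj₂ (state ν)) ≡ length (proj₂ (state π)) → ν ∼cr π →
  proj₁ (state ν) ≡ proj₁ (state π) × proj₂ (state ν) ↭ proj₂ (state π)
∼cr⁻ {ν} {π} cν cπ len ν∼π = v≡ , ↭-map⁻ (v +_) (_∸ v) (λ x → m+n∸m≡n v x)
  (subst₂ _↭_ (values-descendants-1 v cs) (trans (cong (λ k → values k (descendants 1 (v′ , cs′))) len)
    (trans (values-descendants-1 v′ cs′) (cong (λ u → map (u +_) cs′) (sym v≡)))) (same 1))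
  where
  v = proj₁ (state ν)
  v′ = proj₁ (state π)
  cs = proj₂ (state ν)
  cs′ = proj₂ (state π)
  same : ∀ l → values (length cs) (descendants l (state ν)) ↭ values (length cs) (descendants l (state π))
  same l = ↭-trans (↭-sym (Tdesc-values l (length cs) cν)) (↭-trans (ν∼π l (length cs)) (Tdesc-values l (length cs) cπ))
  v≡ : v ≡ v′
  v≡ with Perm.∈-resp-↭ (subst₂ _↭_ (values-descendants-0 v cs)
           (trans (cong (λ k → values k (descendants 0 (v′ , cs′))) len) (values-descendants-0 v′ cs′)) (same 0)) (here refl)
  ... | here e = e

-- Attainable states

-- The sorted lists whose set of values is exactly {0, …, l}.
data Stair : ℕ → List ℕ → Set where
  base : Stair 0 (0 ∷ [])
  stay : ∀ {l s} → Stair l s → Stair l (0 ∷ s)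
  rise : ∀ {l s} → Stair l s → Stair (suc l) (0 ∷ map suc s)

0∈stair : ∀ {l s} → Stair l s → 0 ∈ s
0∈stair base     = here refl
0∈stair (stay _) = here refl
0∈stair (rise _) = here refl

0∉map-suc : ∀ {s} → 0 ∉ map suc s
0∉map-suc {s} 0∈ with ∈-map⁻ suc 0∈
... | _ , _ , ()

stair-length : ∀ {l s} → Stair l s → l < length s
stair-length base = z<s
stair-length (stay st) = m<n⇒m<1+n (stair-length st)
stair-length (rise {s = s} st) = s<s (subst (_ <_) (sym (length-map suc s)) (stair-length st))

-- Length singles out `base`, and after the leading 0 a further 0 is present exactly under `stay`.
-- The multiset thus fixes every constructor, which makes stairs canonical forms.
stair-↭⇒≡ : ∀ {l l′ s s′} → Stair l s → Stair l′ s′ → s ↭ s′ → s ≡ s′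
stair-↭⇒≡ base base p = refl
stair-↭⇒≡ base (stay {s = []} ()) p
stair-↭⇒≡ base (stay {s = _ ∷ _} st) p with () ← Perm.↭-length p
stair-↭⇒≡ base (rise {s = []} ()) p
stair-↭⇒≡ base (rise {s = _ ∷ _} st) p with () ← Perm.↭-length p
stair-↭⇒≡ (stay {s = []} ()) base p
stair-↭⇒≡ (stay {s = _ ∷ _} st) base p with () ← Perm.↭-length p
stair-↭⇒≡ (stay st) (stay st′) p = cong (0 ∷_) (stair-↭⇒≡ st st′ (Perm.drop-∷ p))
stair-↭⇒≡ (stay st) (rise st′) p = ⊥-elim (0∉map-suc (Perm.∈-resp-↭ (Perm.drop-∷ p) (0∈stair st)))
stair-↭⇒≡ (rise {s = []} ()) base p
stair-↭⇒≡ (rise {s = _ ∷ _} st) base p with () ← Perm.↭-length p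
stair-↭⇒≡ (rise st) (stay st′) p = ⊥-elim (0∉map-suc (Perm.∈-resp-↭ (↭-sym (Perm.drop-∷ p)) (0∈stair st′)))
stair-↭⇒≡ (rise st) (rise st′) p =
  cong (λ s → 0 ∷ map suc s) (stair-↭⇒≡ st st′ (↭-map⁻ suc pred (λ _ → refl) (Perm.drop-∷ p)))

-- A value of at most l + 1 leaves no gap above l, so the support remains an initial segment.
stair-insert : ∀ {l s} c → Stair l s → c ≤ suc l → ∃ λ s′ → Stair (l ⊔ c) s′ × s′ ↭ c ∷ s
stair-insert zero base le = 0 ∷ 0 ∷ [] , stay base , ↭-refl
stair-insert (suc zero) base le = 0 ∷ 1 ∷ [] , rise base , swap 0 1 ↭-refl
stair-insert (suc (suc c)) base (s≤s ())
stair-insert c (stay st) le with stair-insert c st le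
... | s′ , st′ , p = 0 ∷ s′ , stay st′ , ↭-trans (prep 0 p) (swap 0 c ↭-refl)
stair-insert zero (rise {s = s} st) le = 0 ∷ 0 ∷ map suc s , stay (rise st) , ↭-refl
stair-insert (suc c) (rise st) (s≤s le) with stair-insert c st le
... | s′ , st′ , p = 0 ∷ map suc s′ , rise st′ , ↭-trans (prep 0 (Perm.map⁺ suc p)) (swap 0 (suc c) ↭-refl)

-- Necessary conditions on states

data Chain : ℕ → List ℕ → Set where
  []  : ∀ {b} → Chain b []
  _∷_ : ∀ {b c cs} → c ≤ b → Chain (suc c) cs → Chain b (c ∷ cs)

Chain-weaken : ∀ {b b′ cs} → b ≤ b′ → Chain b cs → Chain b′ cs
Chain-weaken le []       = []
Chain-weaken le (c ∷ ch) = ≤-trans c le ∷ ch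

-- Removing d makes its neighbours adjacent. If x precedes d, then x has become x + 1, and the entry
-- after d is at most d + 1 ≤ x + 2, so the chain condition persists.
Chain-pick : ∀ {b} X d Y → Chain b (X ++ d ∷ Y) → Chain (suc b) (map suc X ++ Y)
Chain-pick []      d Y (d≤b ∷ ch) = Chain-weaken (s≤s d≤b) ch
Chain-pick (x ∷ X) d Y (x≤b ∷ ch) = s≤s x≤b ∷ Chain-pick X d Y ch

maximum : List ℕ → ℕ
maximum = foldr _⊔_ 0

maximum-++ : ∀ X Y → maximum (X ++ Y) ≡ maximum X ⊔ maximum Y
maximum-++ []      Y = refl
maximum-++ (x ∷ X) Y = trans (cong (x ⊔_) (maximum-++ X Y)) (sym (⊔-assoc x (maximum X) (maximum Y)))

maximum-suc : ∀ X → maximum X ≤ maximum (map suc X) × maximum (map suc X) ≤ suc (maximum X)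
maximum-suc [] = z≤n , z≤n
maximum-suc (x ∷ X) with maximum-suc X
... | l , u = ⊔-mono-≤ (n≤1+n x) l , ⊔-lub (s≤s (m≤m⊔n x (maximum X))) (≤-trans u (s≤s (m≤n⊔m x (maximum X))))

-- The entry just before d becomes at least d after its increment. Hence, starting from bound 0,
-- removing d does not lower the maximum.
Chain-bound : ∀ {b} X d Y → Chain b (X ++ d ∷ Y) → d ≤ b ⊔ maximum (map suc X)
Chain-bound {b} []      d Y (d≤b ∷ ch) = ≤-trans d≤b (m≤m⊔n b 0)
Chain-bound {b} (x ∷ X) d Y (x≤b ∷ ch) = ≤-trans (Chain-bound X d Y ch) (m≤n⊔m b _)

maximum-↭ : ∀ {xs ys} → xs ↭ ys → maximum xs ≡ maximum ys
maximum-↭ _↭_.refl        = refl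
maximum-↭ (prep x p)      = cong (x ⊔_) (maximum-↭ p)
maximum-↭ (swap {xs} {ys} x y p) = begin
  x ⊔ (y ⊔ maximum xs) ≡⟨ ⊔-assoc x y _ ⟨
  x ⊔ y ⊔ maximum xs   ≡⟨ cong₂ _⊔_ (⊔-comm x y) (maximum-↭ p) ⟩
  y ⊔ x ⊔ maximum ys   ≡⟨ ⊔-assoc y x _ ⟩
  y ⊔ (x ⊔ maximum ys) ∎
  where open ≡-Reasoning
maximum-↭ (_↭_.trans p q) = trans (maximum-↭ p) (maximum-↭ q)

stair-maximum : ∀ {l s} → Stair l s → maximum s ≡ l
stair-maximum base      = refl
stair-maximum (stay st) = stair-maximum st
stair-maximum (rise {s = s} st) = trans (go (0∈stair st)) (cong suc (stair-maximum st))
  where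
  go : ∀ {x s} → x ∈ s → maximum (map suc s) ≡ suc (maximum s)
  go {s = y ∷ []}    _ = cong suc (sym (⊔-identityʳ y))
  go {s = y ∷ z ∷ s} _ = cong (suc y ⊔_) (go {s = z ∷ s} (here refl))

-- Here s sorts the entries read so far; b ≤ l + 1 ensures that the next entry, at most b, can be
-- inserted without a gap.
Chain⇒stair′ : ∀ {b l s cs} → Chain b cs → Stair l s → b ≤ suc l → ∃ λ l′ → ∃ λ s′ → Stair l′ s′ × s′ ↭ s ++ cs
Chain⇒stair′ {s = s} [] st le = _ , s , st , subst (s ↭_) (sym (++-identityʳ s)) ↭-refl
Chain⇒stair′ {l = l} {s} {c ∷ cs} (c≤b ∷ ch) st le with stair-insert c st (≤-trans c≤b le)
... | s₁ , st₁ , p with Chain⇒stair′ ch st₁ (s≤s (m≤n⊔m l c))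
...   | l′ , s′ , st′ , q = l′ , s′ , st′ , ↭-trans q (↭-trans (Perm.++⁺ʳ cs p) (↭-sym (Perm.shift c s cs)))

Chain⇒stair : ∀ {c cs} → Chain 0 (c ∷ cs) → ∃ λ s → Stair (maximum (c ∷ cs)) s × s ↭ c ∷ cs
Chain⇒stair (z≤n ∷ ch) with Chain⇒stair′ ch base ≤-refl
... | l , s , st , p = s , subst (λ m → Stair m s) (trans (sym (stair-maximum st)) (maximum-↭ p)) st , p

-- An arc followed by t right endpoints of other arcs is crossed at its own right endpoint by at most
-- t arcs, and by at most l because no more than l + 1 arcs are open at once.
maxCr : ℕ → ℕ → ℕ
maxCr zero    l = 0
maxCr (suc a) l = maxCr a l + a ⊓ l

maxCr-mono : ∀ a {l l′} → l ≤ l′ → maxCr a l ≤ maxCr a l′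
maxCr-mono zero    le = z≤n
maxCr-mono (suc a) le = +-mono-≤ (maxCr-mono a le) (⊓-monoʳ-≤ a le)

record Bounded (n : ℕ) (s : State) : Set where
  constructor bounded
  field
    arcCount : ℕ
    size     : n ≡ arcCount + length (proj₂ s)
    chain    : Chain 0 (proj₂ s)
    height   : maximum (proj₂ s) ≤ arcCount
    crBound  : proj₁ s ≤ maxCr arcCount (maximum (proj₂ s))

Bounded-pick : ∀ {n v} X d Y → Bounded n (v , X ++ d ∷ Y) → Bounded (suc n) (v + d , 0 ∷ map suc X ++ Y)
Bounded-pick {n} {v} X d Y (bounded a size ch h cr≤) = bounded (suc a) size′ (z≤n ∷ Chain-pick X d Y ch) h′ cr′
  where
  open ≤-Reasoning
  old′ = maximum (X ++ d ∷ Y)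
  new′ = maximum (map suc X ++ Y)
  size′ : suc n ≡ suc a + suc (length (map suc X ++ Y))
  size′ = cong suc (trans size (cong (a +_) (trans (length-++ X) (trans (+-suc (length X) (length Y))
    (cong suc (sym (trans (length-++ (map suc X)) (cong (_+ length Y) (length-map suc X)))))))))
  X≤ : maximum X ≤ old′
  X≤ = subst (maximum X ≤_) (sym (maximum-++ X (d ∷ Y))) (m≤m⊔n _ _)
  dY≤ : d ⊔ maximum Y ≤ old′
  dY≤ = subst (d ⊔ maximum Y ≤_) (sym (maximum-++ X (d ∷ Y))) (m≤n⊔m (maximum X) _)
  h′ : new′ ≤ suc a
  h′ = begin
    new′                               ≡⟨ maximum-++ (map suc X) Y ⟩
    maximum (map suc X) ⊔ maximum Y    ≤⟨ ⊔-lub (≤-trans (proj₂ (maximum-suc X)) (s≤s X≤))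
                                                (≤-trans (≤-trans (m≤n⊔m d _) dY≤) (n≤1+n _)) ⟩
    suc old′                           ≤⟨ s≤s h ⟩
    suc a                              ∎
  grows : old′ ≤ new′
  grows = begin
    old′                                    ≡⟨ maximum-++ X (d ∷ Y) ⟩
    maximum X ⊔ (d ⊔ maximum Y)             ≤⟨ ⊔-lub (≤-trans (proj₁ (maximum-suc X)) (m≤m⊔n _ _))
                                                 (⊔-lub (≤-trans (Chain-bound X d Y ch) (m≤m⊔n _ _)) (m≤n⊔m (maximum (map suc X)) _)) ⟩
    maximum (map suc X) ⊔ maximum Y         ≡⟨ maximum-++ (map suc X) Y ⟨
    new′                                    ∎
  d≤ : d ≤ old′
  d≤ = ≤-trans (m≤m⊔n d _) dY≤
  -- The added d is at most a by `height` and at most the new maximum. As the maximum did not drop,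
  -- the old bound may be read with the new one.
  cr′ : v + d ≤ maxCr a new′ + a ⊓ new′
  cr′ = +-mono-≤ (≤-trans cr≤ (maxCr-mono a grows)) (⊓-glb (≤-trans d≤ h) (≤-trans d≤ grows))

state-bounded : ∀ w → Bounded (length w) (state w)
state-bounded [] = bounded 0 refl [] z≤n z≤n
state-bounded (x ∷ w) with prepend? x w | state-bounded w
... | fresh _ eq | bounded a size ch h cr≤ rewrite eq =
  bounded a (trans (cong suc size) (sym (+-suc a _))) (z≤n ∷ Chain-weaken z≤n ch) h cr≤
... | moved P d Q split eq | bd rewrite eq = subst (λ cs → Bounded (suc (length w)) (proj₁ (profile w) + d , 0 ∷ cs))
  (sym (trans (map-++ proj₂ (map (map₂ suc) P) Q) (cong (_++ map proj₂ Q) (trans (sym (map-∘ P)) (map-∘ P)))))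
  (Bounded-pick (map proj₂ P) d (map proj₂ Q)
    (subst (λ cs → Bounded (length w) (proj₁ (profile w) , cs)) (trans (cong (map proj₂) split) (map-++ proj₂ P ((x , d) ∷ Q))) bd))

-- Realising every admissible state

Reachable : ℕ → State → Set
Reachable n s = ∃ λ w → length w ≡ n × state w ≡ s

reach-new : ∀ {n v cs} → Reachable n (v , cs) → Reachable (suc n) (v , 0 ∷ cs)
reach-new (w , refl , refl) = nblocks w ∷ w , refl , state-fresh (nblocks w) w (fresh∉ w)

∈-picks : ∀ X d Y → (d , map suc X ++ Y) ∈ picks (X ++ d ∷ Y)
∈-picks []      d Y = here refl
∈-picks (x ∷ X) d Y = there (∈-map⁺ (map₂ (suc x ∷_)) (∈-picks X d Y))

reach-pick : ∀ {n v} X d Y → Reachable n (v , X ++ d ∷ Y) → Reachable (suc n) (v + d , 0 ∷ map suc X ++ Y)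
reach-pick {v = v} X d Y (w , len , eq) with ∈-map⁻ (λ i → state (i ∷ w)) {xs = nblocks w ∷ labels w}
  (subst ((v + d , 0 ∷ map suc X ++ Y) ∈_)
    (trans (cong successors (sym eq)) (sym (successors-state (nblocks w) w (fresh∉ w))))
    (there (∈-map⁺ (attach v) (∈-picks X d Y))))
... | i , _ , e = i ∷ w , cong suc len , sym e

split-at : ∀ i (L : List ℕ) → i < length L → ∃ λ X → ∃ λ d → ∃ λ Y → L ≡ X ++ d ∷ Y × length X ≡ i
split-at zero    (d ∷ Y) _ = [] , d , Y , refl , refl
split-at (suc i) (x ∷ L) (s<s i<) with split-at i L i<
... | X , d , Y , refl , e = x ∷ X , d , Y , refl , cong suc e

-- What d loses as an entry it gains as crossings; the net change is the increment of each entry of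
-- X.
sum-pick : ∀ X d Y → d + sum (map suc X ++ Y) ≡ sum (X ++ d ∷ Y) + length X
sum-pick []      d Y = sym (+-identityʳ _)
sum-pick (x ∷ X) d Y = begin
  d + (suc x + sum (map suc X ++ Y)) ≡⟨ e₁ d x _ ⟩
  suc (x + (d + sum (map suc X ++ Y))) ≡⟨ cong (λ z → suc (x + z)) (sum-pick X d Y) ⟩
  suc (x + (sum (X ++ d ∷ Y) + length X)) ≡⟨ e₂ x _ _ ⟩
  x + sum (X ++ d ∷ Y) + suc (length X) ∎
  where
  open ≡-Reasoning
  e₁ : ∀ d x s → d + (suc x + s) ≡ suc (x + (d + s))
  e₁ = solve-∀
  e₂ : ∀ x s t → suc (x + (s + t)) ≡ x + s + suc t
  e₂ = solve-∀

-- Picking the entry at position i of O raises the potential v + sum O by exactly i.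
pick-potential : ∀ {n v} X O i w → i < length O → v + sum O ≡ w → Reachable n (v , X ++ O) →
  ∃ λ v′ → ∃ λ O′ → suc (length O′) ≡ length O × v′ + sum O′ ≡ w + i × Reachable (suc n) (v′ , 0 ∷ map suc X ++ O′)
pick-potential {n} {v} X O i w i< pot r with split-at i O i<
... | X₁ , d , Y , refl , refl = v + d , map suc X₁ ++ Y , len , pot′ , r′
  where
  len : suc (length (map suc X₁ ++ Y)) ≡ length (X₁ ++ d ∷ Y)
  len = trans (cong suc (trans (length-++ (map suc X₁)) (cong (_+ length Y) (length-map suc X₁))))
    (trans (sym (+-suc (length X₁) (length Y))) (sym (length-++ X₁)))
  pot′ : v + d + sum (map suc X₁ ++ Y) ≡ w + length X₁
  pot′ = trans (+-assoc v d _) (trans (cong (v +_) (sum-pick X₁ d Y)) (trans (sym (+-assoc v _ _)) (cong (_+ length X₁) pot)))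
  r′ : Reachable (suc n) (v + d , 0 ∷ map suc X ++ map suc X₁ ++ Y)
  r′ = subst (λ cs → Reachable (suc n) (v + d , 0 ∷ cs))
    (trans (cong (_++ Y) (map-++ suc X X₁)) (++-assoc (map suc X) (map suc X₁) Y))
    (reach-pick (X ++ X₁) d Y (subst (λ cs → Reachable n (v , cs)) (sym (++-assoc X X₁ (d ∷ Y))) r))

-- Greedy spending: of the amount w, as much as possible up to i goes into one portion, and the rest
-- fits the budget r of the other.
cut : ∀ w i r → w ≤ i + r → w ∸ w ⊓ i ≤ r × w ∸ w ⊓ i + w ⊓ i ≡ w
cut w i r le = subst (_≤ r) (sym (m∸n⊓m w i)) (subst (w ∸ i ≤_) (m+n∸m≡n i r) (∸-monoˡ-≤ i le)) , m∸n+n≡m (m⊓n≤m w i)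
  where
  m∸n⊓m : ∀ w i → w ∸ w ⊓ i ≡ w ∸ i
  m∸n⊓m w i with ≤-total w i
  ... | inj₁ w≤i rewrite m≤n⇒m⊓n≡m w≤i = trans (n∸n≡0 w) (sym (m≤n⇒m∸n≡0 w≤i))
  ... | inj₂ i≤w rewrite m≥n⇒m⊓n≡n i≤w = refl

reach-zeros : ∀ l → ∃ λ O → length O ≡ l × sum O ≡ 0 × Reachable l (0 , O)
reach-zeros zero    = [] , refl , refl , [] , refl , refl
reach-zeros (suc l) with reach-zeros l
... | O , len , s , r = 0 ∷ O , cong suc len , s , reach-new r

-- Each attachment among the l + 1 entries of `0 ∷ O` restores this shape and is worth any amount
-- from 0 to l.
reach-plateau : ∀ l e w → w ≤ e * l →
  ∃ λ v → ∃ λ O → length O ≡ l × v + sum O ≡ w × Reachable (suc l + e) (v , 0 ∷ O)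
reach-plateau l zero    zero z≤n with reach-zeros l
... | O , len , s , r = 0 , O , len , s , subst (λ n → Reachable n (0 , 0 ∷ O)) (sym (+-identityʳ (suc l))) (reach-new r)
reach-plateau l (suc e) w le with cut w l (e * l) le
... | w₁≤ , w≡ with reach-plateau l e (w ∸ w ⊓ l) w₁≤
... | v , O , refl , pot , r with pick-potential [] (0 ∷ O) (w ⊓ l) (w ∸ w ⊓ l) (s≤s (m⊓n≤n w l)) pot r
... | v′ , O′ , len′ , pot′ , r′ = v′ , O′ , suc-injective len′ , trans pot′ w≡
  , subst (λ n → Reachable n (v′ , 0 ∷ O′)) (sym (+-suc (suc l) e)) r′

triangle : ℕ → ℕ
triangle zero    = 0
triangle (suc l) = triangle l + l

-- A `stay` opens a block. A `rise` attaches to an entry of the reserve behind s, which increments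
-- all of s and costs one reserve entry. Seen from the outermost inwards, the l rises are worth up
-- to r, r + 1, ..., r + l - 1, together l * r + `triangle l`. The 0 of `base` heads the list from
-- the start, hence `suc n′`.
reach-stair : ∀ {l s} → Stair l s → ∀ r {n v O p w} → length O ≡ l + r → v + sum O ≡ p → w ≤ l * r + triangle l →
  Reachable n (v , 0 ∷ O) →
  ∃ λ v′ → ∃ λ O′ → ∃ λ n′ → suc n′ ≡ n + length s × length O′ ≡ r × v′ + sum O′ ≡ p + w × Reachable n′ (v′ , s ++ O′)
reach-stair base r {n} {v} {O} len pot z≤n re = v , O , n , +-comm 1 n , len , trans pot (sym (+-identityʳ _)) , re
reach-stair (stay st) r {n} len pot le re with reach-stair st r len pot le re
... | v′ , O′ , n′ , size , len′ , pot′ , re′ =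
  v′ , O′ , suc n′ , trans (cong suc size) (sym (+-suc n _)) , len′ , pot′ , reach-new re′
reach-stair {suc l} (rise {s = s} st) r {n} {p = p} {w} len pot le re with cut w r (l * suc r + triangle l) (subst (w ≤_) (arith l r (triangle l)) le)
  where
  arith : ∀ l r t → r + l * r + (t + l) ≡ r + (l * suc r + t)
  arith = solve-∀
... | w₁≤ , w≡ with reach-stair st (suc r) (trans len (sym (+-suc l r))) pot w₁≤ re
... | v′ , O′ , n′ , size , len′ , pot′ , re′
  with pick-potential s O′ (w ⊓ r) _ (subst (w ⊓ r <_) (sym len′) (s≤s (m⊓n≤n w r))) pot′ re′
... | v″ , O″ , len″ , pot″ , re″ = v″ , O″ , suc n′
  , trans (cong suc size) (trans (sym (+-suc n _)) (cong (λ z → n + suc z) (sym (length-map suc s))))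
  , suc-injective (trans len″ len′) , trans pot″ (trans (+-assoc p _ _) (cong (p +_) w≡)) , re″

maxCr-triangle : ∀ a l → a ≤ l → maxCr a l ≡ triangle a
maxCr-triangle zero    l le = refl
maxCr-triangle (suc a) l le = cong₂ _+_ (maxCr-triangle a l (<⇒≤ le)) (m≤n⇒m⊓n≡m (<⇒≤ le))

maxCr≡ : ∀ e l → maxCr (e + l) l ≡ e * l + triangle l
maxCr≡ zero    l = maxCr-triangle l l ≤-refl
maxCr≡ (suc e) l = trans (cong₂ _+_ (maxCr≡ e l) (m≥n⇒m⊓n≡n (m≤n+m l e))) (arith l (e * l) (triangle l))
  where
  arith : ∀ l x t → x + t + l ≡ l + x + t
  arith = solve-∀

-- The value v is distributed over the a - l plateau attachments, worth up to l each, and the l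
-- rises, together worth up to `triangle l`.
reach-all : ∀ {l s} a v → Stair l s → l ≤ a → v ≤ maxCr a l → Reachable (a + length s) (v , s)
reach-all {l} {s} a v st l≤a v≤ with a ∸ l | m∸n+n≡m l≤a
... | e | refl with cut v (e * l) (triangle l) (subst (v ≤_) (maxCr≡ e l) v≤)
... | w₂≤ , w≡ with reach-plateau l e (v ⊓ (e * l)) (m⊓n≤n v (e * l))
... | v₁ , O , len , pot , r with reach-stair st 0 (trans len (sym (+-identityʳ l))) pot
  (subst (v ∸ v ⊓ (e * l) ≤_) (cong (_+ triangle l) (sym (*-zeroʳ l))) w₂≤) r
-- The reserve is used up, so the potential is now the crossing number itself.
... | v′ , [] , n′ , size , refl , pot′ , r′ = subst₂ (λ n u → Reachable n u)
  (suc-injective (trans size (cong (λ z → suc (z + length s)) (+-comm l e))))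
  (cong₂ _,_ (trans (sym (+-identityʳ v′)) (trans pot′ (trans (+-comm (v ⊓ (e * l)) _) w≡))) (++-identityʳ s)) r′

-- Counting the classes

nC0≡1 : ∀ n → n C 0 ≡ 1
nC0≡1 n = trans (nCk≡nC[n∸k] {0} {n} z≤n) (nCn≡1 n)

stairs : ℕ → ℕ → List (List ℕ)
stairs zero    zero    = (0 ∷ []) ∷ []
stairs zero    (suc l) = []
stairs (suc j) zero    = map (0 ∷_) (stairs j zero)
stairs (suc j) (suc l) = map (0 ∷_) (stairs j (suc l)) ++ map (λ s → 0 ∷ map suc s) (stairs j l)

-- A stair of length j + 1 is a choice of which l of the j constructors above `base` are rises;
-- splitting by the outermost one is Pascal's rule.
length-stairs : ∀ j l → length (stairs j l) ≡ j C l
length-stairs zero    zero    = refl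
length-stairs zero    (suc l) = sym (k>n⇒nCk≡0 {0} {suc l} z<s)
length-stairs (suc j) zero    = trans (length-map (0 ∷_) (stairs j 0))
  (trans (length-stairs j 0) (trans (nC0≡1 j) (sym (nC0≡1 (suc j)))))
length-stairs (suc j) (suc l) = begin
  length (map (0 ∷_) (stairs j (suc l)) ++ map (λ s → 0 ∷ map suc s) (stairs j l))
    ≡⟨ length-++ (map (0 ∷_) (stairs j (suc l))) ⟩
  length (map (0 ∷_) (stairs j (suc l))) + length (map (λ s → 0 ∷ map suc s) (stairs j l))
    ≡⟨ cong₂ _+_ (trans (length-map _ (stairs j (suc l))) (length-stairs j (suc l)))
                 (trans (length-map _ (stairs j l)) (length-stairs j l)) ⟩
  j C suc l + j C l
    ≡⟨ +-comm (j C suc l) (j C l) ⟩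
  j C l + j C suc l
    ≡⟨ nCk+nC[k+1]≡[n+1]C[k+1] j l ⟩
  suc j C suc l ∎
  where open ≡-Reasoning

∈-stairs⁻ : ∀ j l {s} → s ∈ stairs j l → Stair l s × length s ≡ suc j
∈-stairs⁻ zero zero (here refl) = base , refl
∈-stairs⁻ (suc j) zero s∈ with ∈-map⁻ (0 ∷_) s∈
... | t , t∈ , refl with ∈-stairs⁻ j zero t∈
...   | st , len = stay st , cong suc len
∈-stairs⁻ (suc j) (suc l) s∈ with ∈-++⁻ (map (0 ∷_) (stairs j (suc l))) s∈
... | inj₁ s∈′ with ∈-map⁻ (0 ∷_) s∈′
...   | t , t∈ , refl with ∈-stairs⁻ j (suc l) t∈
...     | st , len = stay st , cong suc len
∈-stairs⁻ (suc j) (suc l) s∈ | inj₂ s∈′ with ∈-map⁻ (λ s → 0 ∷ map suc s) s∈′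
...   | t , t∈ , refl with ∈-stairs⁻ j l t∈
...     | st , len = rise st , cong suc (trans (length-map suc t) len)

∈-stairs⁺ : ∀ j {l s} → Stair l s → length s ≡ suc j → s ∈ stairs j l
∈-stairs⁺ zero    base len = here refl
∈-stairs⁺ (suc j) base ()
∈-stairs⁺ zero    (stay {s = []} ()) len
∈-stairs⁺ zero    (rise {s = []} ()) len
∈-stairs⁺ (suc j) {zero}  (stay st) len = ∈-map⁺ (0 ∷_) (∈-stairs⁺ j st (suc-injective len))
∈-stairs⁺ (suc j) {suc l} (stay st) len = ∈-++⁺ˡ (∈-map⁺ (0 ∷_) (∈-stairs⁺ j st (suc-injective len)))
∈-stairs⁺ (suc j) (rise {l} {s} st) len = ∈-++⁺ʳ (map (0 ∷_) (stairs j (suc l)))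
  (∈-map⁺ (λ s → 0 ∷ map suc s) (∈-stairs⁺ j st (trans (sym (length-map suc s)) (suc-injective len))))

stairs-unique : ∀ j l → Unique (stairs j l)
stairs-unique zero    zero    = [] ∷ []
stairs-unique zero    (suc l) = []
stairs-unique (suc j) zero    = Uniq.map⁺ ∷-injectiveʳ (stairs-unique j 0)
stairs-unique (suc j) (suc l) = Uniq.++⁺ (Uniq.map⁺ ∷-injectiveʳ (stairs-unique j (suc l)))
  (Uniq.map⁺ (λ e → map-injective suc-injective (∷-injectiveʳ e)) (stairs-unique j l))
  λ (p , q) → disjoint p q
  where
  disjoint : ∀ {s} → s ∈ map (0 ∷_) (stairs j (suc l)) → ¬ s ∈ map (λ s → 0 ∷ map suc s) (stairs j l)
  disjoint p q with ∈-map⁻ (0 ∷_) p | ∈-map⁻ (λ s → 0 ∷ map suc s) q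
  ... | t , t∈ , refl | u , u∈ , e =
    0∉map-suc (subst (0 ∈_) (∷-injectiveʳ e) (0∈stair (proj₁ (∈-stairs⁻ j (suc l) t∈))))

length-cartesianProduct : ∀ {A B : Set} (xs : List A) (ys : List B) →
  length (cartesianProduct xs ys) ≡ length xs * length ys
length-cartesianProduct []       ys = refl
length-cartesianProduct (x ∷ xs) ys = trans (length-++ (map (x ,_) ys))
  (cong₂ _+_ (length-map (x ,_) ys) (length-cartesianProduct xs ys))

-- Here a = n - k is the number of arcs and j = k - 1, which avoids truncated subtraction.
module Classes (a j : ℕ) where

  level : ℕ → List State
  level l = cartesianProduct (upTo (suc (maxCr a l))) (stairs j l)

  classes : List State
  classes = concatMap level (upTo (suc (a ⊓ j)))

  ∈-level⁻ : ∀ l {v s} → (v , s) ∈ level l → v ≤ maxCr a l × Stair l s × length s ≡ suc j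
  ∈-level⁻ l p∈ with ∈-cartesianProduct⁻ (upTo (suc (maxCr a l))) (stairs j l) p∈
  ... | v∈ , s∈ = s≤s⁻¹ (∈-upTo⁻ v∈) , ∈-stairs⁻ j l s∈

  classes-unique : Unique classes
  classes-unique = concatMap-unique level (Uniq.upTo⁺ (suc (a ⊓ j)))
    (λ {l} _ → Uniq.cartesianProduct⁺ (Uniq.upTo⁺ (suc (maxCr a l))) (stairs-unique j l))
    λ {l} {l′} _ _ z∈ z∈′ → trans (sym (stair-maximum (proj₁ (proj₂ (∈-level⁻ l z∈)))))
                                  (stair-maximum (proj₁ (proj₂ (∈-level⁻ l′ z∈′))))

  ∈-classes⁻ : ∀ {v s} → (v , s) ∈ classes → ∃ λ l → l ≤ a × v ≤ maxCr a l × Stair l s × length s ≡ suc j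
  ∈-classes⁻ p∈ with find (∈-concatMap⁻ level {xs = upTo (suc (a ⊓ j))} p∈)
  ... | l , l∈ , p∈′ = l , ≤-trans (s≤s⁻¹ (∈-upTo⁻ l∈)) (m⊓n≤m a j) , ∈-level⁻ l p∈′

  -- Both limits in m = min(n - k, k - 1) appear: l ≤ a is assumed, and l ≤ j holds because the
  -- values 0, ..., l need l + 1 entries.
  ∈-classes⁺ : ∀ {l v s} → l ≤ a → v ≤ maxCr a l → Stair l s → length s ≡ suc j → (v , s) ∈ classes
  ∈-classes⁺ {l} l≤a v≤ st len = ∈-concatMap⁺ level (lose
    (∈-upTo⁺ (s≤s (⊓-glb l≤a (s≤s⁻¹ (subst (l <_) len (stair-length st))))))
    (∈-cartesianProduct⁺ (∈-upTo⁺ (s≤s v≤)) (∈-stairs⁺ j st len)))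

  classSize : ℕ → ℕ
  classSize l = suc (maxCr a l) * (j C l)

  length-classes : length classes ≡ sum (map classSize (upTo (suc (a ⊓ j))))
  length-classes = go (upTo (suc (a ⊓ j)))
    where
    go : ∀ ls → length (concatMap level ls) ≡ sum (map classSize ls)
    go []       = refl
    go (l ∷ ls) = trans (length-++ (level l)) (cong₂ _+_
      (trans (length-cartesianProduct (upTo (suc (maxCr a l))) (stairs j l)) (cong₂ _*_ (length-upTo (suc (maxCr a l))) (length-stairs j l)))
      (go ls))

  n k : ℕ
  k = suc j
  n = a + k

  Represents : State → List ℕ → Set
  Represents s w = PartNK n k w × state w ≡ s

  partition⇒ : ∀ {w} → PartNK n k w → Canonical w × length w ≡ n × length (proj₂ (state w)) ≡ k
  partition⇒ (w∈ , b) with ∈Π⇒ w∈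
  ... | c , len = c , len , trans (sym (nblocks≡ c)) b

  represent : ∀ {s} → s ∈ classes → ∃ (Represents s)
  represent {v , s} s∈ with ∈-classes⁻ s∈
  ... | l , l≤a , v≤ , st , len with reach-all a v st l≤a v≤
  ...   | w , lenw , eq = std w
    , (subst (λ m → std w ∈ Π m) (trans (length-std w) (trans lenw (cong (a +_) len))) (∈Π⁺ (std-canonical w))
      , trans (nblocks≡ (std-canonical w)) (trans (cong (λ s → length (proj₂ s)) eq′) len))
    , eq′
    where
    eq′ : state (std w) ≡ (v , s)
    eq′ = trans (state-std w) eq

  represent-≢ : ∀ {s s′ w w′} → s ∈ classes → s′ ∈ classes → Represents s w → Represents s′ w′ → s ≢ s′ → ¬ (w ∼cr w′)
  represent-≢ {v , s} {v′ , s′} s∈ s′∈ (p , refl) (p′ , refl) s≢ w∼ with partition⇒ p | partition⇒ p′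
  ... | c , _ , len | c′ , _ , len′ with ∼cr⁻ c c′ (trans len (sym len′)) w∼ | ∈-classes⁻ s∈ | ∈-classes⁻ s′∈
  ...   | v≡ , cs↭ | _ , _ , _ , st , _ | _ , _ , _ , st′ , _ = s≢ (cong₂ _,_ v≡ (stair-↭⇒≡ st st′ cs↭))

  classify : ∀ {w} → PartNK n k w → ∃ λ s → s ∈ classes × (∀ {ρ} → Represents s ρ → w ∼cr ρ)
  classify {w} p with partition⇒ p | state-bounded w
  ... | c , refl-len , len | bounded a′ size ch h cr≤
    -- A partition of a + k elements into k blocks has exactly a arcs.
    with +-cancelʳ-≡ k a′ a (trans (cong (a′ +_) (sym len)) (trans (sym size) refl-len))
  ... | refl with proj₂ (state w) in eq
  ...   | _ ∷ _ with Chain⇒stair ch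
  ...     | s , st , s↭ = (proj₁ (state w) , s) , ∈-classes⁺ h cr≤ st (trans (Perm.↭-length s↭) len)
    , λ {ρ} (pρ , e) → ∼cr⁺ c (proj₁ (partition⇒ pρ)) (sym (cong proj₁ e))
        (subst₂ _↭_ (sym eq) (sym (cong proj₂ e)) (↭-sym s↭))

  choose : ∀ {ss} → (∀ {s} → s ∈ ss → ∃ (Represents s)) → ∃ λ ws → Pointwise Represents ss ws
  choose {[]}     _ = [] , []
  choose {s ∷ ss} f with f (here refl) | choose {ss} (λ i → f (there i))
  ... | w , r | ws , rs = w ∷ ws , r ∷ rs

  chosen-partitions : ∀ {ss ws} → Pointwise Represents ss ws → All (PartNK n k) ws
  chosen-partitions []             = []
  chosen-partitions ((p , _) ∷ rs) = p ∷ chosen-partitions rs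

  chosen-∼ : ∀ {s ss ws w} → Pointwise Represents ss ws → s ∈ ss → (∀ {ρ} → Represents s ρ → w ∼cr ρ) → Any (w ∼cr_) ws
  chosen-∼ (r ∷ rs) (here refl) f = here (f r)
  chosen-∼ (r ∷ rs) (there s∈)  f = there (chosen-∼ rs s∈ f)

  chosen-≁ : ∀ {ss ws} → (∀ {s} → s ∈ ss → s ∈ classes) → Unique ss → Pointwise Represents ss ws →
    AllPairs (λ u v → ¬ (u ∼cr v)) ws
  chosen-≁ sub []       []       = []
  chosen-≁ {s ∷ ss} sub (s∉ ∷ u) (_∷_ {y = w} r rs) = first (λ i → sub (there i)) s∉ rs ∷ chosen-≁ (λ i → sub (there i)) u rs
    where
    first : ∀ {ss ws} → (∀ {s} → s ∈ ss → s ∈ classes) → All (s ≢_) ss → Pointwise Represents ss ws → All (λ v → ¬ (w ∼cr v)) ws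
    first sub′ []         []         = []
    first sub′ (s≢ ∷ s∉) (r′ ∷ rs′) = represent-≢ (sub (here refl)) (sub′ (here refl)) r r′ s≢ ∷ first (λ i → sub′ (there i)) s∉ rs′

  numClasses : NumClasses n k (length classes)
  numClasses with choose {classes} represent
  ... | ws , rs = ws , sym (Pointwise-length rs) , chosen-partitions rs , chosen-≁ (λ i → i) classes-unique rs
    , λ w p → let s , s∈ , f = classify p in chosen-∼ rs s∈ f

-- The formulas

-- Opened only here: the prefix +_ makes sections of _+_ ambiguous.
import Data.Integer as ℤ
open import Data.Integer using (ℤ; +_) renaming (_*_ to _*ℤ_)
import Data.Integer.Properties as ℤₚ
open import Data.Integer.Tactic.RingSolver using () renaming (solve-∀ to ℤ-solve-∀)

triangle-double : ∀ l → triangle l + triangle l + l ≡ l * l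
triangle-double zero    = refl
triangle-double (suc l) = trans (arith (triangle l) l) (trans (cong (λ z → z + suc (l + l)) (triangle-double l)) (arith′ l))
  where
  arith : ∀ t l → t + l + (t + l) + suc l ≡ t + t + l + suc (l + l)
  arith = solve-∀
  arith′ : ∀ l → l * l + suc (l + l) ≡ suc l * suc l
  arith′ = solve-∀

triangle≡ : ∀ l → (l * (l ∸ 1)) / 2 ≡ triangle l
triangle≡ zero    = refl
triangle≡ (suc l) = trans (cong (_/ 2) (sym double)) (m*n/n≡m (triangle l + l) 2)
  where
  double : (triangle l + l) * 2 ≡ suc l * l
  double = trans (arith (triangle l) l) (trans (cong (_+ l) (triangle-double l)) (+-comm (l * l) l))
    where
    arith : ∀ t l → (t + l) * 2 ≡ t + t + l + l
    arith = solve-∀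

-- Source of the bracket in the formula, stated additively to stay in ℕ: with a = e + l, the sum is
-- e * l plus twice `triangle l` plus l, and the last two make l * l.
maxCr-linear : ∀ {a l} → l ≤ a → maxCr a l + triangle l + l ≡ a * l
maxCr-linear {a} {l} l≤a with a ∸ l | m∸n+n≡m l≤a
... | e | refl = begin
  maxCr (e + l) l + triangle l + l            ≡⟨ cong (λ z → z + triangle l + l) (maxCr≡ e l) ⟩
  e * l + triangle l + triangle l + l         ≡⟨ arith (e * l) (triangle l) l ⟩
  e * l + (triangle l + triangle l + l)       ≡⟨ cong (λ z → e * l + z) (triangle-double l) ⟩
  e * l + l * l                               ≡⟨ *-distribʳ-+ l e l ⟨
  (e + l) * l                                 ∎
  where
  open ≡-Reasoning
  arith : ∀ x t l → x + t + t + l ≡ x + (t + t + l)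
  arith = solve-∀

maxCr-ℤ : ∀ {a l} → l ≤ a → (+ maxCr a l) ≡ ((+ a ℤ.- + 1) ℤ.* + l) ℤ.- + triangle l
maxCr-ℤ {a} {l} l≤a = begin
  M                                           ≡⟨ arith M t (+ l) ⟩
  (M ℤ.+ t ℤ.+ + l) ℤ.- + l ℤ.- t              ≡⟨ cong (λ z → z ℤ.- + l ℤ.- t) cast ⟩
  (+ a ℤ.* + l) ℤ.- + l ℤ.- t                  ≡⟨ arith′ (+ a) (+ l) t ⟩
  ((+ a ℤ.- + 1) ℤ.* + l) ℤ.- t                ∎
  where
  open ≡-Reasoning
  M = + maxCr a l
  t = + triangle l
  cast : M ℤ.+ t ℤ.+ + l ≡ + a ℤ.* + l
  cast = trans (cong +_ (maxCr-linear l≤a)) (ℤₚ.pos-* a l)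
  arith : ∀ M t l → M ≡ (M ℤ.+ t ℤ.+ l) ℤ.- l ℤ.- t
  arith = ℤ-solve-∀
  arith′ : ∀ a l t → (a ℤ.* l) ℤ.- l ℤ.- t ≡ ((a ℤ.- + 1) ℤ.* l) ℤ.- t
  arith′ = ℤ-solve-∀

-- Binomial sums of quadratics

sumℤ : List ℤ → ℤ
sumℤ = foldr ℤ._+_ (+ 0)

+sum≡ : ∀ (f : ℕ → ℕ) (g : ℕ → ℤ) {ls} → All (λ l → + f l ≡ g l) ls → + sum (map f ls) ≡ sumℤ (map g ls)
+sum≡ f g []       = refl
+sum≡ f g (e ∷ es) = cong₂ ℤ._+_ e (+sum≡ f g es)

sumTo : ℕ → (ℕ → ℤ) → ℤ
sumTo zero    h = + 0
sumTo (suc n) h = h 0 ℤ.+ sumTo n (λ l → h (suc l))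

sumℤ-applyUpTo : ∀ (g : ℕ → ℤ) (f : ℕ → ℕ) n → sumℤ (map g (applyUpTo f n)) ≡ sumTo n (λ l → g (f l))
sumℤ-applyUpTo g f zero    = refl
sumℤ-applyUpTo g f (suc n) = cong (λ z → g (f 0) ℤ.+ z) (sumℤ-applyUpTo g (λ l → f (suc l)) n)

sumTo-cong : ∀ n {h h′} → (∀ l → h l ≡ h′ l) → sumTo n h ≡ sumTo n h′
sumTo-cong zero    e = refl
sumTo-cong (suc n) e = cong₂ ℤ._+_ (e 0) (sumTo-cong n λ l → e (suc l))

sumTo-0 : ∀ n → sumTo n (λ _ → + 0) ≡ + 0
sumTo-0 zero    = refl
sumTo-0 (suc n) = trans (ℤₚ.+-identityˡ _) (sumTo-0 n)

sumTo-+ : ∀ n h h′ → sumTo n (λ l → h l ℤ.+ h′ l) ≡ sumTo n h ℤ.+ sumTo n h′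
sumTo-+ zero    h h′ = refl
sumTo-+ (suc n) h h′ = trans (cong (λ z → (h 0 ℤ.+ h′ 0) ℤ.+ z) (sumTo-+ n _ _)) (arith (h 0) (h′ 0) _ _)
  where
  arith : ∀ a b c d → (a ℤ.+ b) ℤ.+ (c ℤ.+ d) ≡ (a ℤ.+ c) ℤ.+ (b ℤ.+ d)
  arith = ℤ-solve-∀

-- The operator (1 + shift)^j applied to h and evaluated at 0, a form of the binomial sum without
-- binomial coefficients.
binomialSum : ℕ → (ℕ → ℤ) → ℤ
binomialSum zero    h = h 0
binomialSum (suc j) h = binomialSum j h ℤ.+ binomialSum j (λ l → h (suc l))

sumTo-binomial : ∀ j n h → j < n → sumTo n (λ l → + (j C l) ℤ.* h l) ≡ binomialSum j h
sumTo-binomial zero (suc n) h _ = begin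
  + (0 C 0) ℤ.* h 0 ℤ.+ sumTo n (λ l → + (0 C suc l) ℤ.* h (suc l))
    ≡⟨ cong₂ ℤ._+_ (ℤₚ.*-identityˡ (h 0)) (trans (sumTo-cong n λ l → cong (λ c → + c ℤ.* h (suc l)) (k>n⇒nCk≡0 {0} {suc l} z<s)) (sumTo-0 n)) ⟩
  h 0 ℤ.+ + 0
    ≡⟨ ℤₚ.+-identityʳ (h 0) ⟩
  h 0 ∎
  where open ≡-Reasoning
sumTo-binomial (suc j) (suc n) h (s<s j<n) = begin
  + (suc j C 0) ℤ.* h 0 ℤ.+ sumTo n (λ l → + (suc j C suc l) ℤ.* h (suc l))
    ≡⟨ cong₂ ℤ._+_ (cong (λ c → + c ℤ.* h 0) (trans (nC0≡1 (suc j)) (sym (nC0≡1 j))))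
                   (trans (sumTo-cong n pascal) (sumTo-+ n _ _)) ⟩
  + (j C 0) ℤ.* h 0 ℤ.+ (sumTo n (λ l → + (j C l) ℤ.* h (suc l)) ℤ.+ sumTo n (λ l → + (j C suc l) ℤ.* h (suc l)))
    ≡⟨ arith (+ (j C 0) ℤ.* h 0) (sumTo n (λ l → + (j C l) ℤ.* h (suc l))) _ ⟩
  sumTo (suc n) (λ l → + (j C l) ℤ.* h l) ℤ.+ sumTo n (λ l → + (j C l) ℤ.* h (suc l))
    ≡⟨ cong₂ ℤ._+_ (sumTo-binomial j (suc n) h (m<n⇒m<1+n j<n)) (sumTo-binomial j n (λ l → h (suc l)) j<n) ⟩
  binomialSum j h ℤ.+ binomialSum j (λ l → h (suc l)) ∎
  where
  open ≡-Reasoning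
  arith : ∀ a b c → a ℤ.+ (b ℤ.+ c) ≡ (a ℤ.+ c) ℤ.+ b
  arith = ℤ-solve-∀
  pascal : ∀ l → + (suc j C suc l) ℤ.* h (suc l) ≡ + (j C l) ℤ.* h (suc l) ℤ.+ + (j C suc l) ℤ.* h (suc l)
  pascal l = trans (cong (λ c → + c ℤ.* h (suc l)) (sym (nCk+nC[k+1]≡[n+1]C[k+1] j l)))
    (ℤₚ.*-distribʳ-+ (h (suc l)) (+ (j C l)) (+ (j C suc l)))

binomialSum-cong : ∀ j {h h′} → (∀ l → h l ≡ h′ l) → binomialSum j h ≡ binomialSum j h′
binomialSum-cong zero    e = e 0
binomialSum-cong (suc j) e = cong₂ ℤ._+_ (binomialSum-cong j e) (binomialSum-cong j λ l → e (suc l))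

-- Written in the basis 1, l, l(l-1)/2, on which the shift acts by adding neighbouring coefficients.
quadratic : ℤ → ℤ → ℤ → ℕ → ℤ
quadratic p q r l = p ℤ.+ q ℤ.* + l ℤ.+ r ℤ.* + triangle l

quadratic-suc : ∀ p q r l → quadratic p q r (suc l) ≡ quadratic (p ℤ.+ q) (q ℤ.+ r) r l
quadratic-suc p q r l = arith p q r (+ l) (+ triangle l)
  where
  arith : ∀ p q r l t → p ℤ.+ q ℤ.* (+ 1 ℤ.+ l) ℤ.+ r ℤ.* (t ℤ.+ l) ≡ (p ℤ.+ q) ℤ.+ (q ℤ.+ r) ℤ.* l ℤ.+ r ℤ.* t
  arith = ℤ-solve-∀

-- The binomial sums of the three basis functions are 2^j, j 2^(j-1) and j(j-1) 2^(j-3); the factor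
-- 8 clears negative exponents.
binomialSum-quadratic : ∀ j p q r → + 8 ℤ.* binomialSum j (quadratic p q r) ≡
  + (2 ^ j) ℤ.* (+ 8 ℤ.* p ℤ.+ + 4 ℤ.* + j ℤ.* q ℤ.+ + j ℤ.* (+ j ℤ.- + 1) ℤ.* r)
binomialSum-quadratic zero    p q r = arith p q r
  where
  arith : ∀ p q r → + 8 ℤ.* (p ℤ.+ q ℤ.* + 0 ℤ.+ r ℤ.* + 0) ≡
    + 1 ℤ.* (+ 8 ℤ.* p ℤ.+ + 4 ℤ.* + 0 ℤ.* q ℤ.+ + 0 ℤ.* (+ 0 ℤ.- + 1) ℤ.* r)
  arith = ℤ-solve-∀
binomialSum-quadratic (suc j) p q r = begin
  + 8 ℤ.* (binomialSum j (quadratic p q r) ℤ.+ binomialSum j (λ l → quadratic p q r (suc l)))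
    ≡⟨ ℤₚ.*-distribˡ-+ (+ 8) (binomialSum j (quadratic p q r)) _ ⟩
  + 8 ℤ.* binomialSum j (quadratic p q r) ℤ.+ + 8 ℤ.* binomialSum j (λ l → quadratic p q r (suc l))
    ≡⟨ cong₂ ℤ._+_ (binomialSum-quadratic j p q r)
         (trans (cong (+ 8 ℤ.*_) (binomialSum-cong j (quadratic-suc p q r))) (binomialSum-quadratic j (p ℤ.+ q) (q ℤ.+ r) r)) ⟩
  _ ≡⟨ arith (+ (2 ^ j)) (+ j) p q r ⟩
  (+ 2 ℤ.* + (2 ^ j)) ℤ.* body
    ≡⟨ cong (ℤ._* body) (ℤₚ.pos-* 2 (2 ^ j)) ⟨
  + (2 ^ suc j) ℤ.* body ∎
  where
  open ≡-Reasoning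
  body : ℤ
  body = + 8 ℤ.* p ℤ.+ + 4 ℤ.* (+ 1 ℤ.+ + j) ℤ.* q ℤ.+ (+ 1 ℤ.+ + j) ℤ.* ((+ 1 ℤ.+ + j) ℤ.- + 1) ℤ.* r
  arith : ∀ x j p q r →
    x ℤ.* (+ 8 ℤ.* p ℤ.+ + 4 ℤ.* j ℤ.* q ℤ.+ j ℤ.* (j ℤ.- + 1) ℤ.* r)
      ℤ.+ x ℤ.* (+ 8 ℤ.* (p ℤ.+ q) ℤ.+ + 4 ℤ.* j ℤ.* (q ℤ.+ r) ℤ.+ j ℤ.* (j ℤ.- + 1) ℤ.* r)
    ≡ (+ 2 ℤ.* x) ℤ.* (+ 8 ℤ.* p ℤ.+ + 4 ℤ.* (+ 1 ℤ.+ j) ℤ.* q ℤ.+ (+ 1 ℤ.+ j) ℤ.* ((+ 1 ℤ.+ j) ℤ.- + 1) ℤ.* r)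
  arith = ℤ-solve-∀

module Count (a j : ℕ) where
  open Classes a j

  summand : ℕ → ℤ
  summand l = + (j C l) ℤ.* (((+ n ℤ.- + k ℤ.- + 1) ℤ.* + l) ℤ.- + ((l * (l ∸ 1)) / 2) ℤ.+ + 1)

  n-k : + n ℤ.- + k ≡ + a
  n-k = arith (+ a) (+ k)
    where
    arith : ∀ a k → (a ℤ.+ k) ℤ.- k ≡ a
    arith = ℤ-solve-∀

  classSize≡ : ∀ {l} → l ≤ a → + classSize l ≡ summand l
  classSize≡ {l} l≤a = begin
    + (suc (maxCr a l) * (j C l))                    ≡⟨ cong +_ (*-comm (suc (maxCr a l)) (j C l)) ⟩
    + ((j C l) * suc (maxCr a l))                    ≡⟨ ℤₚ.pos-* (j C l) (suc (maxCr a l)) ⟩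
    + (j C l) ℤ.* (+ 1 ℤ.+ + maxCr a l)              ≡⟨ cong (+ (j C l) ℤ.*_) (ℤₚ.+-comm (+ 1) (+ maxCr a l)) ⟩
    + (j C l) ℤ.* (+ maxCr a l ℤ.+ + 1)              ≡⟨ cong (λ z → + (j C l) ℤ.* (z ℤ.+ + 1)) (maxCr-ℤ l≤a) ⟩
    + (j C l) ℤ.* (((+ a ℤ.- + 1) ℤ.* + l) ℤ.- + triangle l ℤ.+ + 1)
      ≡⟨ cong₂ (λ x t → + (j C l) ℤ.* (((x ℤ.- + 1) ℤ.* + l) ℤ.- + t ℤ.+ + 1)) (sym n-k) (sym (triangle≡ l)) ⟩
    summand l ∎
    where open ≡-Reasoning

  count≡ : + length classes ≡ sumℤ (map summand (upTo (suc (a ⊓ j))))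
  count≡ = trans (cong +_ length-classes) (+sum≡ classSize summand
    (All.tabulate λ l∈ → classSize≡ (≤-trans (s≤s⁻¹ (∈-upTo⁻ l∈)) (m⊓n≤m a j))))

  count-formula : + length classes ≡ formula n k
  count-formula = subst (λ m → + length classes ≡ sumℤ (map summand (upTo (suc (m ⊓ j))))) (sym (m+n∸n≡m a k)) count≡

  count-closed : 2 * k ∸ 1 ≤ n → + 16 ℤ.* + length classes ≡ closed16 n k
  count-closed big = begin
    + 16 ℤ.* + length classes
      ≡⟨ cong (+ 16 ℤ.*_) (trans count≡ (cong (λ m → sumℤ (map summand (upTo (suc m)))) (m≥n⇒m⊓n≡n j≤a))) ⟩
    + 16 ℤ.* sumℤ (map summand (upTo (suc j)))
      ≡⟨ cong (+ 16 ℤ.*_) (trans (sumℤ-applyUpTo summand (λ l → l) (suc j)) (sumTo-cong (suc j) reshape)) ⟩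
    + 16 ℤ.* sumTo (suc j) (λ l → + (j C l) ℤ.* quadratic (+ 1) A (ℤ.- + 1) l)
      ≡⟨ cong (+ 16 ℤ.*_) (sumTo-binomial j (suc j) _ ≤-refl) ⟩
    + 16 ℤ.* B
      ≡⟨ double B ⟩
    + 2 ℤ.* (+ 8 ℤ.* B)
      ≡⟨ cong (+ 2 ℤ.*_) (binomialSum-quadratic j (+ 1) A (ℤ.- + 1)) ⟩
    + 2 ℤ.* (+ (2 ^ j) ℤ.* (+ 8 ℤ.* + 1 ℤ.+ + 4 ℤ.* + j ℤ.* A ℤ.+ + j ℤ.* (+ j ℤ.- + 1) ℤ.* (ℤ.- + 1)))
      ≡⟨ expand (+ (2 ^ j)) (+ j) A ⟩
    (A ℤ.* + j ℤ.* (+ (2 ^ j) ℤ.* + 8)) ℤ.+ (+ (2 ^ j) ℤ.* + 16) ℤ.- (+ j ℤ.* (+ j ℤ.- + 1)) ℤ.* (+ (2 ^ j) ℤ.* + 2)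
      ≡⟨ cong₂ ℤ._-_ (cong₂ (λ x y → (A ℤ.* + j ℤ.* x) ℤ.+ y) (power 3 k+2) (power 4 k+3)) (cong₂ ℤ._*_ j[j-1] (power 1 (+-comm j 1))) ⟩
    closed16 n k ∎
    where
    open ≡-Reasoning
    A B : ℤ
    A = + n ℤ.- + k ℤ.- + 1
    B = binomialSum j (quadratic (+ 1) A (ℤ.- + 1))
    -- `2 * k ∸ 1` computes to `j + (k + 0)`, so the hypothesis reads j + k ≤ a + k. Then the sum
    -- runs over all l up to j.
    j≤a : j ≤ a
    j≤a = +-cancelʳ-≤ k j a (subst (_≤ n) (cong (λ z → j + z) (+-identityʳ k)) big)
    reshape : ∀ l → summand l ≡ + (j C l) ℤ.* quadratic (+ 1) A (ℤ.- + 1) l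
    reshape l = trans (cong (λ t → + (j C l) ℤ.* ((A ℤ.* + l) ℤ.- + t ℤ.+ + 1)) (triangle≡ l)) (arith (+ (j C l)) A (+ l) (+ triangle l))
      where
      arith : ∀ c A l t → c ℤ.* ((A ℤ.* l) ℤ.- t ℤ.+ + 1) ≡ c ℤ.* (+ 1 ℤ.+ A ℤ.* l ℤ.+ (ℤ.- + 1) ℤ.* t)
      arith = ℤ-solve-∀
    double : ∀ b → + 16 ℤ.* b ≡ + 2 ℤ.* (+ 8 ℤ.* b)
    double = ℤ-solve-∀
    expand : ∀ x j A → + 2 ℤ.* (x ℤ.* (+ 8 ℤ.* + 1 ℤ.+ + 4 ℤ.* j ℤ.* A ℤ.+ j ℤ.* (j ℤ.- + 1) ℤ.* (ℤ.- + 1))) ≡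
      (A ℤ.* j ℤ.* (x ℤ.* + 8)) ℤ.+ (x ℤ.* + 16) ℤ.- (j ℤ.* (j ℤ.- + 1)) ℤ.* (x ℤ.* + 2)
    expand = ℤ-solve-∀
    power : ∀ i {m} → j + i ≡ m → + (2 ^ j) ℤ.* + (2 ^ i) ≡ + (2 ^ m)
    power i refl = trans (sym (ℤₚ.pos-* (2 ^ j) (2 ^ i))) (cong +_ (sym (^-distribˡ-+-* 2 j i)))
    k+2 : j + 3 ≡ k + 2
    k+2 = +-suc j 2
    k+3 : j + 4 ≡ k + 3
    k+3 = +-suc j 3
    -- At j = 0 truncation gives 0 in place of -1, which the factor j annihilates.
    j[j-1] : + j ℤ.* (+ j ℤ.- + 1) ≡ + j ℤ.* + (j ∸ 1)
    j[j-1] = go j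
      where
      go : ∀ j → + j ℤ.* (+ j ℤ.- + 1) ≡ + j ℤ.* + (j ∸ 1)
      go zero    = refl
      go (suc j) = refl

theorem4p5 : (n k : ℕ) → 1 ≤ k → k ≤ n →
    Σ ℕ (λ N → NumClasses n k N
    × (+ N ≡ formula n k)
    × (2 * k ∸ 1 ≤ n → (+ 16) *ℤ (+ N) ≡ closed16 n k))
theorem4p5 n (suc j) _ k≤n =
  subst (λ n → Σ ℕ (λ N → NumClasses n (suc j) N × (+ N ≡ formula n (suc j))
      × (2 * suc j ∸ 1 ≤ n → (+ 16) *ℤ (+ N) ≡ closed16 n (suc j))))
    (m∸n+n≡m k≤n) (length classes , numClasses , count-formula , count-closed)
  where
  open Classes (n ∸ suc j) j using (classes; numClasses)
  open Count (n ∸ suc j) j using (count-formula; count-closed)
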